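{- For online class constrained bin packing with parameter $t=2$, every online algorithm has asymptotic competitive ratio at least $1.717668486$. For $t=3$, every online algorithm has asymptotic competitive ratio at least $1.80814287$.
   Context: In class constrained bin packing with an integer parameter $t\ge 1$, each item has a rational size in $(0,1]$ and a color. Items are packed into bins so that the total size of items in each bin is at most $1$ and each bin contains items of at most $t$ distinct colors; the number of items of any one color in a bin is unrestricted. The cost is the number of bins used. In the online version, items (with their sizes and colors) arrive one by one and each must be irrevocably assigned to a bin before the next item is revealed. Online algorithms are deterministic. For an algorithm $A$ and input $I$, let $A(I)$ be its cost and $OPT(I)$ the minimum possible cost. Let $c(Q)=\max\{A(I): OPT(I)=Q\}$, and define the asymptotic competitive ratio as $R_A=\limsup_{Q\to\infty} c(Q)/Q$. -}

module Defs where

open import Data.Nat as ℕ using (ℕ; _<_; _≥_; _≟_)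
open import Data.Integer using (+_)
open import Data.Rational as ℚ using (ℚ; _/_; 0ℚ; 1ℚ)
open import Data.List using (List; []; _∷_; _++_; [_]; map; filter; deduplicate; length; foldr)
open import Data.List.Relation.Unary.All using (All)
open import Data.Product using (Σ; _×_; _,_; proj₁; proj₂; ∃-syntax)
open import Relation.Nullary using (¬_)
open import Relation.Binary.PropositionalEquality using (_≡_)

record Item : Set where
  constructor item
  field
    size     : ℚ
    size>0   : 0ℚ ℚ.< size
    size≤1   : size ℚ.≤ 1ℚ
    color    : ℕ
open Item public

-- A packing: each item paired with the label of the bin it is put into.
Packing : Set
Packing = List (Item × ℕ)

binContents : Packing → ℕ → List Item
binContents P b = map proj₁ (filter (λ p → proj₂ p ≟ b) P)

load : List Item → ℚ
load xs = foldr (λ x s → size x ℚ.+ s) 0ℚ xs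

numColors : List Item → ℕ
numColors xs = length (deduplicate _≟_ (map color xs))

Feasible : ℕ → Packing → Set
Feasible t P = ∀ b → (load (binContents P b) ℚ.≤ 1ℚ) × (numColors (binContents P b) ℕ.≤ t)

binsUsed : Packing → ℕ
binsUsed P = length (deduplicate _≟_ (map proj₂ P))

PacksInto : ℕ → List Item → ℕ → Set
PacksInto t I k = Σ (List ℕ) λ ls →
  (length ls ≡ length I) × All (_< k) ls × Feasible t (Data.List.zip I ls)
  where import Data.List

OptIs : ℕ → List Item → ℕ → Set
OptIs t I Q = PacksInto t I Q × (∀ k → k < Q → ¬ PacksInto t I k)

-- A deterministic online strategy: given the items seen so far and the new
-- item, choose a bin label (previous decisions are determined by the prefix).
Strategy : Set
Strategy = List Item → Item → ℕ

runFrom : Strategy → List Item → List Item → Packing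
runFrom A seen []       = []
runFrom A seen (x ∷ xs) = (x , A seen x) ∷ runFrom A (seen ++ [ x ]) xs

run : Strategy → List Item → Packing
run A I = runFrom A [] I

OnlineAlg : ℕ → Set
OnlineAlg t = Σ Strategy λ A → ∀ (I : List Item) → Feasible t (run A I)

cost : ∀ {t} → OnlineAlg t → List Item → ℕ
cost (A , _) I = binsUsed (run A I)

toℚ : ℕ → ℚ
toℚ n = + n / 1

-- R_A ≥ r, i.e. limsup_{Q→∞} c(Q)/Q ≥ r with c(Q) = max{A(I) : OPT(I) = Q},
-- unfolded: for all ε > 0 and all Q₀ there is Q ≥ Q₀ and an input I with
-- OPT(I) = Q and A(I) ≥ (r - ε)·Q.
RatioAtLeast : ∀ {t} → OnlineAlg t → ℚ → Set
RatioAtLeast {t} A r = ∀ (ε : ℚ) → 0ℚ ℚ.< ε → ∀ (Q₀ : ℕ) →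
  ∃[ Q ] (Q ≥ Q₀ × ∃[ I ] (OptIs t I Q × ((r ℚ.- ε) ℚ.* toℚ Q ℚ.≤ toℚ (cost A I))))

-- The adversary shows that the ratio is at least 2 - 1 / 2t, that is 7/4 for t = 2 and 11/6 for t = 3.
--
-- Tiny items of tm distinct colors arrive, their sizes (powers of a huge base) chosen adaptively: the first item
-- of a bin outweighs all non-first ("small") items of all bins together, and the first items decrease in size.
-- Group t colors into a class and complete its tiny items by one large item to a total size of exactly 1: then
-- m bins suffice. The large item fits into no bin with more tiny weight, nor into a bin with t other colors.
-- Let X bins be used, z of them showing t colors. Classes of small items block all X bins, so
-- the cost is about X + (tm - X) / t ≥ 2m - z / t.
-- If z ≥ m / 2, present the colors outside the z full bins again in the same way, at a much larger scale. They
-- touch Y ≥ m - z bins, none of them full. Classes of colors that were small in this phase are blocked by the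
-- full and by the touched bins. So are the classes made of the t - 1 small colors of a full bin and the
-- first color of the next full bin, whose large item takes a small color of that bin.
-- The cost is about z + Y + z + (tm - tz - Y) / t ≥ 2m - (m - z) / t.
module Submission where

open import Defs
open import Data.Bool using (true; false)
open import Data.Empty using (⊥-elim)
open import Data.Integer as ℤ using (+_)
import Data.Integer.Properties as ℤ
open import Data.List
  using (List; []; _∷_; _++_; [_]; map; filter; deduplicate; length; concat; take; drop; upTo; zip)
open import Data.List.Properties
  using (length-map; length-++; map-++; map-∘; filter-++; filter-accept; filter-reject; take++drop≡id; length-upTo;
         length-take; length-drop; drop-all; length-filter; ++-assoc; ++-identityʳ; concat-++)
open import Data.List.Membership.Propositional using (_∈_; _∉_)
open import Data.List.Membership.Propositional.Properties
open import Data.List.Relation.Binary.Disjoint.Propositional using (Disjoint)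
open import Data.List.Relation.Binary.Subset.Propositional using (_⊆_)
open import Data.List.Relation.Unary.All as All using (All; []; _∷_)
import Data.List.Relation.Unary.All.Properties as All
open import Data.List.Relation.Unary.AllPairs as AllPairs using (AllPairs; []; _∷_)
import Data.List.Relation.Unary.AllPairs.Properties as AllPairs
open import Data.List.Relation.Unary.Any using (here; there)
open import Data.List.Relation.Unary.Unique.Propositional using (Unique)
import Data.List.Relation.Unary.Unique.Propositional.Properties as Unique
import Data.List.Relation.Unary.Unique.DecPropositional.Properties as DecUnique
open import Data.Nat hiding (_/_)
open import Data.Nat.ListAction using (sum)
import Data.Nat.DivMod as ℕ using (_/_; m/n*n≤m; m≡m%n+[m/n]*n; m%n<n)
open import Data.Nat.Properties
open import Data.Nat.Tactic.RingSolver using (solve-∀)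
open import Data.List.Membership.DecPropositional _≟_ using (_∈?_)
open import Data.Product using (_×_; _,_; proj₁; proj₂; ∃-syntax)
open import Data.Rational as ℚ using (ℚ; 0ℚ; 1ℚ; _/_)
import Data.Rational.Properties as ℚ
open import Data.Rational.Unnormalised as ℚᵘ using (mkℚᵘ; *≡*; *≤*)
import Data.Rational.Unnormalised.Properties as ℚᵘ
open import Data.Sum as Sum using (_⊎_; inj₁; inj₂)
open import Level using (0ℓ)
open import Function using (_∘_; id; case_of_)
open import Relation.Binary.PropositionalEquality hiding ([_])
open import Relation.Nullary using (¬_; ¬?; yes; no; does)
open import Relation.Unary using (Pred; Decidable)

-- Counting in lists without repetition

private variable
  X Y : Set

unique-⊆⇒length≤ : {xs ys : List X} → Unique xs → xs ⊆ ys → length xs ≤ length ys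
unique-⊆⇒length≤ [] _ = z≤n
unique-⊆⇒length≤ {xs = x ∷ xs} (x∉ ∷ u) sub with ∈-∃++ (sub (here refl))
... | as , bs , refl = begin
  suc (length xs)             ≤⟨ s≤s (unique-⊆⇒length≤ u sub′) ⟩
  suc (length (as ++ bs))     ≡⟨ cong suc (length-++ as) ⟩
  suc (length as + length bs) ≡⟨ +-suc (length as) (length bs) ⟨
  length as + suc (length bs) ≡⟨ length-++ as ⟨
  length (as ++ x ∷ bs)       ∎
  where
  open ≤-Reasoning
  sub′ : xs ⊆ as ++ bs
  sub′ y∈ with ∈-++⁻ as (sub (there y∈))
  ... | inj₁ y∈as = ∈-++⁺ˡ y∈as
  ... | inj₂ (here refl) = ⊥-elim (All.lookup x∉ y∈ refl)
  ... | inj₂ (there y∈bs) = ∈-++⁺ʳ as y∈bs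

length-concat≤ : ∀ n {xss : List (List X)} → All (λ xs → length xs ≤ n) xss → length (concat xss) ≤ n * length xss
length-concat≤ n [] = z≤n
length-concat≤ n {xs ∷ xss} (p ∷ ps) = begin
  length (xs ++ concat xss)       ≡⟨ length-++ xs ⟩
  length xs + length (concat xss) ≤⟨ +-mono-≤ p (length-concat≤ n ps) ⟩
  n + n * length xss              ≡⟨ *-suc n (length xss) ⟨
  n * suc (length xss)            ∎
  where open ≤-Reasoning

-- With n = t - 1 and `R` the full bins, this counts colors bin by bin: a full bin contributes one
-- color more than the others.
length-concat-split : ∀ n {R : Pred X 0ℓ} (R? : Decidable R) {f : X → List Y} {xs : List X} →
                      (∀ {x} → x ∈ xs → length (f x) ≤ suc n) → (∀ {x} → x ∈ xs → ¬ R x → length (f x) ≤ n) →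
                      length (concat (map f xs)) ≤ n * length xs + length (filter R? xs)
length-concat-split n R? {xs = []} _ _ = z≤n
length-concat-split n R? {f} {x ∷ xs} any small with length-concat-split n R? (any ∘ there) (small ∘ there) | R? x
... | ih | yes _ = begin
  length (f x ++ concat (map f xs))                    ≡⟨ length-++ (f x) ⟩
  length (f x) + length (concat (map f xs))            ≤⟨ +-mono-≤ (any (here refl)) ih ⟩
  suc n + (n * length xs + length (filter R? xs))      ≡⟨ regroup n (length xs) (length (filter R? xs)) ⟩
  n * suc (length xs) + suc (length (filter R? xs))    ∎
  where
  open ≤-Reasoning
  regroup : ∀ n k a → suc n + (n * k + a) ≡ n * suc k + suc a
  regroup = solve-∀
... | ih | no ¬Rx = begin
  length (f x ++ concat (map f xs))                    ≡⟨ length-++ (f x) ⟩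
  length (f x) + length (concat (map f xs))            ≤⟨ +-mono-≤ (small (here refl) ¬Rx) ih ⟩
  n + (n * length xs + length (filter R? xs))          ≡⟨ regroup n (length xs) (length (filter R? xs)) ⟩
  n * suc (length xs) + length (filter R? xs)          ∎
  where
  open ≤-Reasoning
  regroup : ∀ n k a → n + (n * k + a) ≡ n * suc k + a
  regroup = solve-∀

unique⇒length≤distinct : ∀ {xs ys} → Unique xs → xs ⊆ ys → length xs ≤ length (deduplicate _≟_ ys)
unique⇒length≤distinct u sub = unique-⊆⇒length≤ u (∈-deduplicate⁺ _≟_ ∘ sub)

distinct≤length : ∀ {xs ys : List ℕ} → xs ⊆ ys → length (deduplicate _≟_ xs) ≤ length ys
distinct≤length {xs} sub = unique-⊆⇒length≤ (DecUnique.deduplicate-! _≟_ xs) (sub ∘ ∈-deduplicate⁻ _≟_ xs)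

unique-map⇒injective : {f : X → Y} {xs : List X} → Unique (map f xs) →
                       ∀ {x y} → x ∈ xs → y ∈ xs → f x ≡ f y → x ≡ y
unique-map⇒injective (_ ∷ _) (here refl) (here refl) _ = refl
unique-map⇒injective {f = f} (p ∷ _) (here refl) (there y∈) eq = ⊥-elim (All.lookup p (∈-map⁺ f y∈) eq)
unique-map⇒injective {f = f} (p ∷ _) (there x∈) (here refl) eq = ⊥-elim (All.lookup p (∈-map⁺ f x∈) (sym eq))
unique-map⇒injective (_ ∷ u) (there x∈) (there y∈) eq = unique-map⇒injective u x∈ y∈ eq

filter-map : {P : Pred Y 0ℓ} (P? : Decidable P) (f : X → Y) (xs : List X) →
             filter P? (map f xs) ≡ map f (filter (P? ∘ f) xs)
filter-map P? f []       = refl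
filter-map P? f (x ∷ xs) with does (P? (f x))
... | true  = cong (f x ∷_) (filter-map P? f xs)
... | false = filter-map P? f xs

-- Cutting colors into classes

chunks : ℕ → ℕ → List X → List (List X)
chunks n zero    xs = []
chunks n (suc k) xs = take n xs ∷ chunks n k (drop n xs)

length-chunks : ∀ n k (xs : List X) → length (chunks n k xs) ≡ k
length-chunks n zero    xs = refl
length-chunks n (suc k) xs = cong suc (length-chunks n k (drop n xs))

-- The `k` lists reach only the first `k * n` entries. The remaining tail is kept as an alternative,
-- so that old colors beyond the last complete class can be passed on to the other classes.
∈-chunks : ∀ n k {xs : List X} {x} → x ∈ xs → x ∈ concat (chunks n k xs) ⊎ x ∈ drop (k * n) xs
∈-chunks n zero    x∈ = inj₂ x∈
∈-chunks n (suc k) {xs} {x} x∈ with ∈-++⁻ (take n xs) (subst (x ∈_) (sym (take++drop≡id n xs)) x∈)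
... | inj₁ x∈t = inj₁ (∈-++⁺ˡ x∈t)
... | inj₂ x∈d with ∈-chunks n k x∈d
...   | inj₁ x∈c = inj₁ (∈-++⁺ʳ (take n xs) x∈c)
...   | inj₂ x∈r = inj₂ (subst (x ∈_) (drop-drop′ n (k * n) xs) x∈r)
  where
  drop-drop′ : ∀ a b (ys : List X) → drop b (drop a ys) ≡ drop (a + b) ys
  drop-drop′ zero    b       ys       = refl
  drop-drop′ (suc a) zero    []       = refl
  drop-drop′ (suc a) (suc b) []       = refl
  drop-drop′ (suc a) b       (y ∷ ys) = drop-drop′ a b ys

take-⊆ : ∀ n {xs : List X} → take n xs ⊆ xs
take-⊆ n {xs} x∈ = subst (_ ∈_) (take++drop≡id n xs) (∈-++⁺ˡ x∈)

drop-⊆ : ∀ n {xs : List X} → drop n xs ⊆ xs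
drop-⊆ n {xs} x∈ = subst (_ ∈_) (take++drop≡id n xs) (∈-++⁺ʳ (take n xs) x∈)

chunks-⊆ : ∀ n k (xs : List X) → All (_⊆ xs) (chunks n k xs)
chunks-⊆ n zero    xs = []
chunks-⊆ n (suc k) xs = take-⊆ n ∷ All.map (λ s {x} x∈ → drop-⊆ n (s x∈)) (chunks-⊆ n k (drop n xs))

chunks-length≤ : ∀ n k (xs : List X) → All (λ ys → length ys ≤ n) (chunks n k xs)
chunks-length≤ n zero    xs = []
chunks-length≤ n (suc k) xs = subst (_≤ n) (sym (length-take n xs)) (m⊓n≤m n _) ∷ chunks-length≤ n k (drop n xs)

chunks-length≡ : ∀ n k (xs : List X) → k * n ≤ length xs → All (λ ys → length ys ≡ n) (chunks n k xs)
chunks-length≡ n zero    xs _ = []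
chunks-length≡ n (suc k) xs h =
  trans (length-take n xs) (m≤n⇒m⊓n≡m (m+n≤o⇒m≤o n h)) ∷
  chunks-length≡ n k (drop n xs) (subst (k * n ≤_) (sym (length-drop n xs))
    (subst (_≤ length xs ∸ n) (m+n∸m≡n n (k * n)) (∸-monoˡ-≤ n h)))

-- Past the end the value is the empty class, so that statements about arbitrary bin labels need no
-- range condition.
nth : List (List X) → ℕ → List X
nth []         _       = []
nth (xs ∷ xss) zero    = xs
nth (xs ∷ xss) (suc n) = nth xss n

nth-++ : ∀ (xss {yss} : List (List X)) {n} → n < length xss → nth (xss ++ yss) n ≡ nth xss n
nth-++ (xs ∷ xss) {n = zero}  _       = refl
nth-++ (xs ∷ xss) {n = suc n} (s≤s h) = nth-++ xss h

nth-All : {P : List X → Set} → P [] → ∀ {xss} → All P xss → ∀ n → P (nth xss n)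
nth-All p[] []       n       = p[]
nth-All p[] (p ∷ ps) zero    = p
nth-All p[] (p ∷ ps) (suc n) = nth-All p[] ps n

position : ℕ → List (List ℕ) → ℕ
position c []         = 0
position c (xs ∷ xss) with c ∈? xs
... | yes _ = 0
... | no  _ = suc (position c xss)

position-correct : ∀ {c} xss → c ∈ concat xss → c ∈ nth xss (position c xss) × position c xss < length xss
position-correct {c} (xs ∷ xss) c∈ with c ∈? xs
... | yes c∈xs = c∈xs , s≤s z≤n
... | no  c∉xs with ∈-++⁻ xs c∈
...   | inj₁ c∈xs = ⊥-elim (c∉xs c∈xs)
...   | inj₂ c∈r with position-correct xss c∈r
...     | q , h = q , s≤s h

-- Packings

binContents-++ : ∀ P Q b → binContents (P ++ Q) b ≡ binContents P b ++ binContents Q b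
binContents-++ P Q b = trans (cong (map proj₁) (filter-++ (λ p → proj₂ p ≟ b) P Q))
                             (map-++ proj₁ (filter _ P) _)

binContents-hit : ∀ {x b b′} Q → b ≡ b′ → binContents ((x , b) ∷ Q) b′ ≡ x ∷ binContents Q b′
binContents-hit {b′ = b′} Q eq = cong (map proj₁) (filter-accept (λ p → proj₂ p ≟ b′) eq)

binContents-miss : ∀ {x b b′} Q → b ≢ b′ → binContents ((x , b) ∷ Q) b′ ≡ binContents Q b′
binContents-miss {b′ = b′} Q neq = cong (map proj₁) (filter-reject (λ p → proj₂ p ≟ b′) neq)

∈-binContents : ∀ {Q : Packing} {x b} → (x , b) ∈ Q → x ∈ binContents Q b
∈-binContents {b = b} x∈ = ∈-map⁺ proj₁ (∈-filter⁺ (λ p → proj₂ p ≟ b) x∈ refl)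

load-++ : ∀ xs ys → load (xs ++ ys) ≡ load xs ℚ.+ load ys
load-++ []       ys = sym (ℚ.+-identityˡ _)
load-++ (x ∷ xs) ys = trans (cong (size x ℚ.+_) (load-++ xs ys)) (sym (ℚ.+-assoc (size x) _ _))

load≥0 : ∀ xs → 0ℚ ℚ.≤ load xs
load≥0 []       = ℚ.≤-refl
load≥0 (x ∷ xs) = ℚ.+-mono-≤ (ℚ.<⇒≤ (size>0 x)) (load≥0 xs)

size≤load : ∀ {x xs} → x ∈ xs → size x ℚ.≤ load xs
size≤load {x} {_ ∷ xs} (here refl) = ℚ.≤-trans (ℚ.≤-reflexive (sym (ℚ.+-identityʳ (size x)))) (ℚ.+-monoʳ-≤ (size x) (load≥0 xs))
size≤load {x} {y ∷ xs} (there x∈) = ℚ.≤-trans (ℚ.≤-reflexive (sym (ℚ.+-identityˡ (size x)))) (ℚ.+-mono-≤ (ℚ.<⇒≤ (size>0 y)) (size≤load x∈))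

runFrom-++ : ∀ A seen xs ys → runFrom A seen (xs ++ ys) ≡ runFrom A seen xs ++ runFrom A (seen ++ xs) ys
runFrom-++ A seen []       ys = cong (λ s → runFrom A s ys) (sym (++-identityʳ seen))
runFrom-++ A seen (x ∷ xs) ys = cong (_ ∷_) (trans (runFrom-++ A (seen ++ [ x ]) xs ys)
  (cong (λ s → runFrom A (seen ++ [ x ]) xs ++ runFrom A s ys) (++-assoc seen [ x ] xs)))

runFrom-items : ∀ A seen xs → map proj₁ (runFrom A seen xs) ≡ xs
runFrom-items A seen []       = refl
runFrom-items A seen (x ∷ xs) = cong (x ∷_) (runFrom-items A _ xs)

colors≤ : ∀ {t Q b ds} → Feasible t Q → Unique ds → ds ⊆ map color (binContents Q b) → length ds ≤ t
colors≤ {b = b} feas u sub = ≤-trans (unique⇒length≤distinct u sub) (proj₂ (feas b))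

-- Each of the k bins of a feasible packing shows at most t colors.
colors≤bins : ∀ {t I k cs} → PacksInto t I k → Unique cs → cs ⊆ map color I → length cs ≤ t * k
colors≤bins {t} {I} {k} {cs} (ls , len , bounded , feas) u sub = begin
  length cs                    ≤⟨ unique-⊆⇒length≤ u cover ⟩
  length (concat palettes)     ≤⟨ length-concat≤ t (All.map⁺ (All.universal (λ b → proj₂ (feas b)) (upTo k))) ⟩
  t * length palettes          ≡⟨ cong (t *_) (trans (length-map palette (upTo k)) (length-upTo k)) ⟩
  t * k                        ∎
  where
  open ≤-Reasoning
  palette : ℕ → List ℕ
  palette b = deduplicate _≟_ (map color (binContents (zip I ls) b))
  palettes = map palette (upTo k)
  labelled : ∀ {x I ls} → length ls ≡ length I → x ∈ I → ∃[ b ] b ∈ ls × (x , b) ∈ zip I ls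
  labelled {ls = b ∷ ls} len (here refl) = b , here refl , here refl
  labelled {ls = b ∷ ls} len (there x∈) with labelled (suc-injective len) x∈
  ... | b′ , b∈ , xb∈ = b′ , there b∈ , there xb∈
  cover : cs ⊆ concat palettes
  cover c∈ with ∈-map⁻ color (sub c∈)
  ... | x , x∈ , refl with labelled len x∈
  ...   | b , b∈ , xb∈ = ∈-concat⁺′ (∈-deduplicate⁺ _≟_ (∈-map⁺ color (∈-binContents xb∈)))
                                    (∈-map⁺ palette (∈-upTo⁺ (All.lookup bounded b∈)))

-- Items whose sizes are multiples of 1 / suc D

module Fractions (D : ℕ) where

  W : ℕ
  W = suc D

  opaque
    fr : ℕ → ℚ
    fr a = + a / W

  opaque
    unfolding fr

    toℚᵘ-fr : ∀ a → ℚ.toℚᵘ (fr a) ℚᵘ.≃ mkℚᵘ (+ a) D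
    toℚᵘ-fr a = ℚ.toℚᵘ-fromℚᵘ (mkℚᵘ (+ a) D)

    fr-+ : ∀ a b → fr a ℚ.+ fr b ≡ fr (a + b)
    fr-+ a b = ℚ.toℚᵘ-injective (begin
      ℚ.toℚᵘ (fr a ℚ.+ fr b)               ≈⟨ ℚ.toℚᵘ-homo-+ (fr a) (fr b) ⟩
      ℚ.toℚᵘ (fr a) ℚᵘ.+ ℚ.toℚᵘ (fr b)     ≈⟨ ℚᵘ.+-cong (toℚᵘ-fr a) (toℚᵘ-fr b) ⟩
      mkℚᵘ (+ a) D ℚᵘ.+ mkℚᵘ (+ b) D       ≈⟨ *≡* (trans (cong (ℤ._* + W) (sym (ℤ.*-distribʳ-+ (+ W) (+ a) (+ b)))) (ℤ.*-assoc (+ (a + b)) (+ W) (+ W))) ⟩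
      mkℚᵘ (+ (a + b)) D                   ≈⟨ toℚᵘ-fr (a + b) ⟨
      ℚ.toℚᵘ (fr (a + b))                  ∎)
      where open ℚᵘ.≃-Reasoning

    fr-mono-≤ : ∀ {a b} → a ≤ b → fr a ℚ.≤ fr b
    fr-mono-≤ {a} {b} h = ℚ.toℚᵘ-cancel-≤ (ℚᵘ.≤-respˡ-≃ (ℚᵘ.≃-sym (toℚᵘ-fr a)) (ℚᵘ.≤-respʳ-≃ (ℚᵘ.≃-sym (toℚᵘ-fr b))
      (*≤* (ℤ.*-monoʳ-≤-nonNeg (+ W) (ℤ.+≤+ h)))))

    fr-cancel-≤ : ∀ {a b} → fr a ℚ.≤ fr b → a ≤ b
    fr-cancel-≤ {a} {b} h with ℚᵘ.≤-respˡ-≃ (toℚᵘ-fr a) (ℚᵘ.≤-respʳ-≃ (toℚᵘ-fr b) (ℚ.toℚᵘ-mono-≤ h))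
    ... | *≤* h′ = ℤ.drop‿+≤+ (ℤ.*-cancelʳ-≤-pos (+ a) (+ b) (+ W) h′)

    fr-W : fr W ≡ 1ℚ
    fr-W = ℚ.toℚᵘ-injective (ℚᵘ.≃-trans (toℚᵘ-fr W) (*≡* (trans (ℤ.*-identityʳ (+ W)) (sym (ℤ.*-identityˡ (+ W))))))

    fr-0 : fr 0 ≡ 0ℚ
    fr-0 = ℚ.0/n≡0 W

  fr≤1 : ∀ {a} → a ≤ W → fr a ℚ.≤ 1ℚ
  fr≤1 h = ℚ.≤-trans (fr-mono-≤ h) (ℚ.≤-reflexive fr-W)

  fr≤1⁻ : ∀ {a} → fr a ℚ.≤ 1ℚ → a ≤ W
  fr≤1⁻ h = fr-cancel-≤ (ℚ.≤-trans h (ℚ.≤-reflexive (sym fr-W)))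

  fr>0 : ∀ {a} → 0 < a → 0ℚ ℚ.< fr a
  fr>0 {a} h = subst (ℚ._< fr a) fr-0 (ℚ.≰⇒> (λ q → <⇒≱ h (fr-cancel-≤ q)))

  -- Makes every natural number an admissible numerator, so that `mk` is total; by `clamp-id` the
  -- weights from 1 to `W` are unchanged.
  clamp : ℕ → ℕ
  clamp w = w ⊓ W ⊔ 1

  clamp-id : ∀ {w} → 0 < w → w ≤ W → clamp w ≡ w
  clamp-id {w} p h = trans (cong (_⊔ 1) (m≤n⇒m⊓n≡m h)) (m≥n⇒m⊔n≡m p)

  opaque
    clamp>0 : ∀ w → 0ℚ ℚ.< fr (clamp w)
    clamp>0 w = fr>0 (m≤n⊔m (w ⊓ W) 1)

    clamp≤1 : ∀ w → fr (clamp w) ℚ.≤ 1ℚ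
    clamp≤1 w = fr≤1 (⊔-lub (m⊓n≤n w W) (s≤s z≤n))

  mk : ℕ → ℕ → Item
  mk w c = item (fr (clamp w)) (clamp>0 w) (clamp≤1 w) c

-- Tiny items whose sizes are powers of a base

record Placed : Set where
  constructor placed
  field
    expo col bin : ℕ
open Placed public

-- The color given to the large item of a class. The value at the empty list is a dummy: in the
-- attack all classes with a large item have t colors.
lead : List ℕ → ℕ
lead []      = 0
lead (c ∷ _) = c

zip-++ : ∀ {xs ys : List X} {as bs : List Y} → length xs ≡ length as →
         zip (xs ++ ys) (as ++ bs) ≡ zip xs as ++ zip ys bs
zip-++ {xs = []}     {as = []}     _  = refl
zip-++ {xs = x ∷ xs} {as = a ∷ as} eq = cong ((x , a) ∷_) (zip-++ {xs = xs} {as = as} (suc-injective eq))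

zip-map-map : {Z : Set} (f : Z → X) (g : Z → Y) (zs : List Z) → zip (map f zs) (map g zs) ≡ map (λ z → f z , g z) zs
zip-map-map f g []       = refl
zip-map-map f g (z ∷ zs) = cong (_ ∷_) (zip-map-map f g zs)

-- A repeated label would put two of these items into one bin, whose load is at least the sum of
-- their sizes.
unique-labels : ∀ Q → (∀ {x y} → x ∈ map proj₁ Q → y ∈ map proj₁ Q → ¬ size x ℚ.+ size y ℚ.≤ 1ℚ) →
                (∀ b → load (binContents Q b) ℚ.≤ 1ℚ) → Unique (map proj₂ Q)
unique-labels []            _    _   = []
unique-labels ((x , b) ∷ Q) huge fit =
  All.¬Any⇒All¬ _ clash ∷ unique-labels Q (λ x∈ y∈ → huge (there x∈) (there y∈)) (λ b′ → ℚ.≤-trans (tail-load b′) (fit b′))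
  where
  tail-load : ∀ b′ → load (binContents Q b′) ℚ.≤ load (binContents ((x , b) ∷ Q) b′)
  tail-load b′ with b ≟ b′
  ... | yes eq = ℚ.≤-trans (ℚ.≤-reflexive (sym (ℚ.+-identityˡ _)))
                   (ℚ.≤-trans (ℚ.+-monoˡ-≤ (load (binContents Q b′)) (ℚ.<⇒≤ (size>0 x)))
                     (ℚ.≤-reflexive (cong load (sym (binContents-hit {x} Q eq)))))
  ... | no neq = ℚ.≤-reflexive (cong load (sym (binContents-miss {x} Q neq)))
  head-load : load (binContents ((x , b) ∷ Q) b) ≡ size x ℚ.+ load (binContents Q b)
  head-load = cong load (binContents-hit {x} Q refl)
  clash : b ∉ map proj₂ Q
  clash b∈ with ∈-map⁻ proj₂ b∈
  ... | (y , _) , yb∈ , refl = huge (here refl) (there (∈-map⁺ proj₁ yb∈))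
    (ℚ.≤-trans (ℚ.+-monoʳ-≤ (size x) (size≤load (∈-binContents yb∈)))
      (ℚ.≤-trans (ℚ.≤-reflexive (sym head-load)) (fit b)))

module Game {t : ℕ} (alg : OnlineAlg t) (D B′ : ℕ) where

  open Fractions D

  A : Strategy
  A = proj₁ alg

  B : ℕ
  B = suc B′

  -- Sizes are counted in units of `1 / W`. The base is going to exceed the number of tiny items, so
  -- that comparing weights reduces to comparing exponents.
  wt : Placed → ℕ
  wt p = B ^ expo p

  itm : Placed → Item
  itm p = mk (wt p) (col p)

  place : Placed → Item × ℕ
  place p = itm p , bin p

  weight : List Placed → ℕ
  weight ps = sum (map wt ps)

  load-itms : ∀ {ps} → All (λ p → wt p ≤ W) ps → load (map itm ps) ≡ fr (weight ps)
  load-itms []                = sym fr-0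
  load-itms {p ∷ ps} (h ∷ hs) = begin
    fr (clamp (wt p)) ℚ.+ load (map itm ps) ≡⟨ cong₂ ℚ._+_ (cong fr (clamp-id (m^n>0 B (expo p)) h)) (load-itms hs) ⟩
    fr (wt p) ℚ.+ fr (weight ps)            ≡⟨ fr-+ (wt p) (weight ps) ⟩
    fr (wt p + weight ps)                   ∎
    where open ≡-Reasoning

  contents-map : ∀ (g : Placed → ℕ) ps b →
                 binContents (map (λ p → itm p , g p) ps) b ≡ map itm (filter (λ p → g p ≟ b) ps)
  contents-map g ps b = trans (cong (map proj₁) (filter-map (λ q → proj₂ q ≟ b) (λ p → itm p , g p) ps)) (sym (map-∘ _))

  module _ {P Q : Pred Placed 0ℓ} (P? : Decidable P) (Q? : Decidable Q) where
    weight-filter-mono : ∀ ps → (∀ {p} → p ∈ ps → P p → Q p) → weight (filter P? ps) ≤ weight (filter Q? ps)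
    weight-filter-mono []       imp = z≤n
    weight-filter-mono (p ∷ ps) imp with P? p | Q? p
    ... | yes _  | yes _  = +-monoʳ-≤ (wt p) (weight-filter-mono ps (imp ∘ there))
    ... | yes Pp | no ¬Qp = ⊥-elim (¬Qp (imp (here refl) Pp))
    ... | no _   | yes _  = ≤-trans (weight-filter-mono ps (imp ∘ there)) (m≤n+m _ (wt p))
    ... | no _   | no _   = weight-filter-mono ps (imp ∘ there)

  module _ {P : Pred Placed 0ℓ} (P? : Decidable P) where
    weight-filter≤ : ∀ ps → weight (filter P? ps) ≤ weight ps
    weight-filter≤ []       = z≤n
    weight-filter≤ (p ∷ ps) with P? p
    ... | yes _ = +-monoʳ-≤ (wt p) (weight-filter≤ ps)
    ... | no _  = ≤-trans (weight-filter≤ ps) (m≤n+m _ (wt p))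

  wt≤weight : ∀ {p ps} → p ∈ ps → wt p ≤ weight ps
  wt≤weight (here refl) = m≤m+n _ _
  wt≤weight {ps = q ∷ _} (there p∈) = ≤-trans (wt≤weight p∈) (m≤n+m _ (wt q))

  -- There are at most `B - 1` items, each of weight at most `B ^ (k - 1)`. Hence one item of
  -- exponent `k` outweighs them all.
  weight<power : ∀ {k ps} → All (λ p → expo p < k) ps → length ps ≤ B′ → weight ps < B ^ k
  weight<power {zero}  []  _ = s≤s z≤n
  weight<power {suc k} {ps} h len = begin-strict
    weight ps          ≤⟨ bound h ⟩
    length ps * B ^ k  <⟨ *-monoˡ-< (B ^ k) {{>-nonZero (m^n>0 B k)}} (s≤s len) ⟩
    B * B ^ k          ∎
    where
    open ≤-Reasoning
    bound : ∀ {ps} → All (λ p → expo p < suc k) ps → weight ps ≤ length ps * B ^ k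
    bound []            = z≤n
    bound (s≤s p ∷ hs) = +-mono-≤ (^-monoʳ-≤ B p) (bound hs)

  -- Large items: online cost and offline packing

  module Finale (P : List Placed) (executed : run A (map itm P) ≡ map place P)
                {H : ℕ} (low : All (λ p → expo p < H) P) (short : length P ≤ B′)
                (room : B ^ H + B ^ H ≤ W) (good rest : List (List ℕ)) where

    classWeight : List ℕ → ℕ
    classWeight G = weight (filter (λ p → col p ∈? G) P)

    big : List ℕ → Item
    big G = mk (W ∸ classWeight G) (lead G)

    input : List Item
    input = map itm P ++ map big good

    -- All tiny items together weigh less than `B ^ H`, and `room` fits this twice into a bin. So
    -- every large item is larger than one half.
    half : ∀ G → classWeight G + classWeight G < W
    half G = begin-strict
      classWeight G + classWeight G <⟨ +-mono-< lt lt ⟩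
      B ^ H + B ^ H                 ≤⟨ room ⟩
      W                             ∎
      where
      open ≤-Reasoning
      lt : classWeight G < B ^ H
      lt = ≤-<-trans (weight-filter≤ _ P) (weight<power low short)

    classWeight<W : ∀ G → classWeight G < W
    classWeight<W G = ≤-<-trans (m≤m+n _ _) (half G)

    size-big : ∀ G → size (big G) ≡ fr (W ∸ classWeight G)
    size-big G = cong fr (clamp-id (m<n⇒0<n∸m (classWeight<W G)) (m∸n≤m W (classWeight G)))

    valid : All (λ p → wt p ≤ W) P
    valid = All.map (λ {p} h → ≤-trans (^-monoʳ-≤ B (<⇒≤ h)) (≤-trans (m≤m+n _ _) room)) low

    atBin : ℕ → List Placed
    atBin β = filter (λ p → bin p ≟ β) P

    -- Two reasons that keep the large item of `G` out of bin `β`: a single tiny item there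
    -- outweighs the whole class, or t colors other than that of the large item are present.
    data Blocked (G : List ℕ) (β : ℕ) : Set where
      overload  : ∀ {y} → y ∈ P → bin y ≡ β → (∀ {p} → p ∈ P → col p ∈ G → expo p < expo y) → Blocked G β
      saturated : ∀ {ds} → Unique ds → length ds ≡ t → All (λ d → ∃[ y ] y ∈ P × bin y ≡ β × col y ≡ d) ds →
                  lead G ∉ ds → Blocked G β

    executed-all : run A input ≡ map place P ++ runFrom A (map itm P) (map big good)
    executed-all = trans (runFrom-++ A [] (map itm P) (map big good)) (cong (_++ runFrom A (map itm P) (map big good)) executed)

    bigRun : Packing
    bigRun = runFrom A (map itm P) (map big good)

    contents-all : ∀ β → binContents (run A input) β ≡ map itm (atBin β) ++ binContents bigRun β
    contents-all β = begin
      binContents (run A input) β                               ≡⟨ cong (λ Q → binContents Q β) executed-all ⟩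
      binContents (map place P ++ bigRun) β                     ≡⟨ binContents-++ (map place P) bigRun β ⟩
      binContents (map place P) β ++ binContents bigRun β       ≡⟨ cong (_++ binContents bigRun β) (contents-map bin P β) ⟩
      map itm (atBin β) ++ binContents bigRun β                 ∎
      where open ≡-Reasoning

    load-all : ∀ β → fr (weight (atBin β)) ℚ.+ load (binContents bigRun β) ℚ.≤ 1ℚ
    load-all β = subst (ℚ._≤ 1ℚ)
      (trans (cong load (contents-all β)) (trans (load-++ (map itm (atBin β)) _)
        (cong (ℚ._+ load (binContents bigRun β)) (load-itms (All.filter⁺ (λ p → bin p ≟ β) valid)))))
      (proj₁ (proj₂ alg input β))

    bigRun-item : ∀ {x} → x ∈ map proj₁ bigRun → ∃[ G ] G ∈ good × x ≡ big G
    bigRun-item x∈ = ∈-map⁻ big (subst (_ ∈_) (runFrom-items A (map itm P) (map big good)) x∈)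

    -- The large item leaves space for exactly `classWeight G`, which by `weight<power` is less than
    -- the weight of an item exceeding the exponents of the class. In a saturated bin its color
    -- would be number t + 1.
    not-blocked : ∀ {G β} → (big G , β) ∈ bigRun → ¬ Blocked G β
    not-blocked {G} {β} G∈ (overload {y} y∈ refl above) = <⇒≱ heavier fits
      where
      heavier : classWeight G < weight (atBin β)
      heavier = <-≤-trans
        (weight<power (All.tabulate (λ p∈ → let p∈P , c∈ = ∈-filter⁻ (λ p → col p ∈? G) p∈ in above p∈P c∈))
          (≤-trans (length-filter (λ p → col p ∈? G) P) short))
        (wt≤weight (∈-filter⁺ (λ p → bin p ≟ β) y∈ refl))
      sum≤W : weight (atBin β) + (W ∸ classWeight G) ≤ W
      sum≤W = fr≤1⁻ (subst (ℚ._≤ 1ℚ) (trans (cong (fr (weight (atBin β)) ℚ.+_) (size-big G)) (fr-+ (weight (atBin β)) _))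
        (ℚ.≤-trans (ℚ.+-monoʳ-≤ (fr (weight (atBin β))) (size≤load (∈-binContents G∈))) (load-all β)))
      fits : weight (atBin β) ≤ classWeight G
      fits = +-cancelʳ-≤ (W ∸ classWeight G) _ _
        (≤-trans sum≤W (≤-reflexive (sym (m+[n∸m]≡n (<⇒≤ (classWeight<W G))))))
    not-blocked {G} {β} G∈ (saturated {ds} u len at ∉ds) =
      1+n≰n (subst (λ n → suc n ≤ t) len (colors≤ {Q = run A input} {ds = lead G ∷ ds} (proj₂ alg input) (All.¬Any⇒All¬ _ ∉ds ∷ u) sub))
      where
      sub : lead G ∷ ds ⊆ map color (binContents (run A input) β)
      sub d∈ = subst (λ c → _ ∈ map color c) (sym (contents-all β)) (case d∈ of λ where
        (here refl) → ∈-map⁺ color (∈-++⁺ʳ (map itm (atBin β)) (∈-binContents G∈))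
        (there d∈) → let y , y∈ , yβ , yd = All.lookup at d∈ in
          subst (_∈ _) yd (∈-map⁺ color (∈-++⁺ˡ (∈-map⁺ itm (∈-filter⁺ (λ p → bin p ≟ β) y∈ yβ)))))

    -- Large items exceed one half, hence occupy pairwise distinct bins, and blocking keeps all of
    -- these apart from `X`.
    cost-bound : ∀ {X} → Unique X → X ⊆ map bin P → (∀ {G β} → G ∈ good → β ∈ X → Blocked G β) →
                 length X + length good ≤ cost alg input
    cost-bound {X} uX X⊆ blocked = begin
      length X + length good             ≡⟨ cong (λ n → length X + n) len ⟨
      length X + length labels           ≡⟨ length-++ X ⟨
      length (X ++ labels)               ≤⟨ unique⇒length≤distinct (Unique.++⁺ uX uL disj) sub ⟩
      binsUsed (run A input)             ∎
      where
      open ≤-Reasoning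
      labels = map proj₂ bigRun
      len : length labels ≡ length good
      len = trans (length-map proj₂ bigRun) (trans (sym (length-map proj₁ bigRun))
        (trans (cong length (runFrom-items A (map itm P) (map big good))) (length-map big good)))
      huge : ∀ {x y} → x ∈ map proj₁ bigRun → y ∈ map proj₁ bigRun → ¬ size x ℚ.+ size y ℚ.≤ 1ℚ
      huge x∈ y∈ le with bigRun-item x∈ | bigRun-item y∈
      ... | G , _ , refl | G′ , _ , refl = <⇒≱ more (fr≤1⁻ (subst (ℚ._≤ 1ℚ)
              (trans (cong₂ ℚ._+_ (size-big G) (size-big G′)) (fr-+ (W ∸ classWeight G) _)) le))
        where
        more : W < (W ∸ classWeight G) + (W ∸ classWeight G′)
        -- Both large items weigh more than half of `W`; comparing doubles avoids halving.
        more = *-cancelˡ-< 2 W _ (begin-strict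
          2 * W ≡⟨ cong (λ n → W + n) (+-identityʳ W) ⟩
          W + W <⟨ +-mono-< (twice G) (twice G′) ⟩
          ((W ∸ classWeight G) + (W ∸ classWeight G)) + ((W ∸ classWeight G′) + (W ∸ classWeight G′))
            ≡⟨ solve-more (W ∸ classWeight G) (W ∸ classWeight G′) ⟩
          2 * ((W ∸ classWeight G) + (W ∸ classWeight G′)) ∎)
          where
          solve-more : ∀ a b → (a + a) + (b + b) ≡ 2 * (a + b)
          solve-more = solve-∀
          twice : ∀ G → W < (W ∸ classWeight G) + (W ∸ classWeight G)
          twice G = begin-strict
            W ≡⟨ m+[n∸m]≡n (<⇒≤ (classWeight<W G)) ⟨
            classWeight G + (W ∸ classWeight G) <⟨ +-monoˡ-< (W ∸ classWeight G) (m+n≤o⇒m≤o∸n _ (half G)) ⟩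
            (W ∸ classWeight G) + (W ∸ classWeight G) ∎
      uL : Unique labels
      uL = unique-labels bigRun huge (λ β → ℚ.≤-trans (ℚ.≤-trans (ℚ.≤-reflexive (sym (ℚ.+-identityˡ _)))
             (ℚ.+-monoˡ-≤ (load (binContents bigRun β)) (subst (ℚ._≤ fr (weight (atBin β))) fr-0 (fr-mono-≤ z≤n)))) (load-all β))
      disj : Disjoint X labels
      disj (β∈X , β∈L) with ∈-map⁻ proj₂ β∈L
      ... | (x , β) , xβ∈ , refl with bigRun-item (∈-map⁺ proj₁ xβ∈)
      ...   | G , G∈ , refl = not-blocked xβ∈ (blocked G∈ β∈X)
      sub : X ++ labels ⊆ map proj₂ (run A input)
      sub β∈ = subst (λ Q → _ ∈ map proj₂ Q) (sym executed-all) (subst (_ ∈_) (sym (map-++ proj₂ (map place P) bigRun))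
        (case ∈-++⁻ X β∈ of λ where
          (inj₁ β∈X) → ∈-++⁺ˡ (subst (_ ∈_) (map-∘ P) (X⊆ β∈X))
          (inj₂ β∈L) → ∈-++⁺ʳ _ β∈L))

    -- Consecutive labels give every good class a bin of its own. The start `k` varies for the
    -- induction; the packing uses 0.
    labelsFrom : ℕ → List (List ℕ) → List ℕ
    labelsFrom k []       = []
    labelsFrom k (_ ∷ gs) = k ∷ labelsFrom (suc k) gs

    bigPacking : ℕ → List (List ℕ) → Packing
    bigPacking k gs = zip (map big gs) (labelsFrom k gs)

    length-labelsFrom : ∀ k gs → length (labelsFrom k gs) ≡ length gs
    length-labelsFrom k []       = refl
    length-labelsFrom k (_ ∷ gs) = cong suc (length-labelsFrom (suc k) gs)

    labelsFrom< : ∀ k gs → All (_< k + length gs) (labelsFrom k gs)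
    labelsFrom< k []       = []
    labelsFrom< k (_ ∷ gs) rewrite +-suc k (length gs) = s≤s (m≤m+n k _) ∷ labelsFrom< (suc k) gs

    bigPacking-below : ∀ {b} k gs → b < k → binContents (bigPacking k gs) b ≡ []
    bigPacking-below     k []       _ = refl
    bigPacking-below {b} k (G ∷ gs) h with k ≟ b
    ... | yes refl = ⊥-elim (<-irrefl refl h)
    ... | no  k≢b  = trans (binContents-miss (bigPacking (suc k) gs) k≢b) (bigPacking-below (suc k) gs (m≤n⇒m≤1+n h))

    bigPacking-at : ∀ k gs b → binContents (bigPacking k gs) b ≡ [] ⊎
                    ∃[ j ] b ≡ k + j × j < length gs × binContents (bigPacking k gs) b ≡ [ big (nth gs j) ]
    bigPacking-at k []       b = inj₁ refl
    bigPacking-at k (G ∷ gs) b with k ≟ b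
    ... | yes refl = inj₂ (0 , sym (+-identityʳ k) , s≤s z≤n ,
        trans (binContents-hit (bigPacking (suc k) gs) refl) (cong (big G ∷_) (bigPacking-below (suc k) gs ≤-refl)))
    ... | no k≢b with bigPacking-at (suc k) gs b
    ...   | inj₁ eq = inj₁ (trans (binContents-miss (bigPacking (suc k) gs) k≢b) eq)
    ...   | inj₂ (j , refl , h , eq) =
      inj₂ (suc j , sym (+-suc k j) , s≤s h , trans (binContents-miss (bigPacking (suc k) gs) k≢b) eq)

    module _ (sizes : All (λ G → length G ≤ t) (good ++ rest)) (led : All (λ G → lead G ∈ G) good)
             (covers : ∀ {p} → p ∈ P → col p ∈ concat (good ++ rest)) where

      -- The label is the index of the first class with the color. As `good` precedes `rest`, the
      -- j-th good class shares label j with its large item.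
      classOf : Placed → ℕ
      classOf p = position (col p) (good ++ rest)

      labels : List ℕ
      labels = map classOf P ++ labelsFrom 0 good

      packing-split : zip input labels ≡ map (λ p → itm p , classOf p) P ++ bigPacking 0 good
      packing-split = trans (zip-++ {xs = map itm P} {as = map classOf P} (trans (length-map itm P) (sym (length-map classOf P))))
                            (cong (_++ bigPacking 0 good) (zip-map-map itm classOf P))

      contents-labels : ∀ b → binContents (zip input labels) b ≡
                        map itm (filter (λ p → classOf p ≟ b) P) ++ binContents (bigPacking 0 good) b
      contents-labels b = trans (cong (λ Q → binContents Q b) packing-split)
        (trans (binContents-++ (map (λ p → itm p , classOf p) P) (bigPacking 0 good) b) (cong (_++ binContents (bigPacking 0 good) b) (contents-map classOf P b)))

      in-class : ∀ {p} → p ∈ P → col p ∈ nth (good ++ rest) (classOf p)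
      in-class p∈ = proj₁ (position-correct (good ++ rest) (covers p∈))

      inClass : ∀ b {p} → p ∈ filter (λ p → classOf p ≟ b) P → col p ∈ nth (good ++ rest) b
      inClass b p∈ with ∈-filter⁻ (λ p → classOf p ≟ b) p∈
      ... | p∈P , refl = in-class p∈P

      smallLoad : ∀ b → load (map itm (filter (λ p → classOf p ≟ b) P)) ≡ fr (weight (filter (λ p → classOf p ≟ b) P))
      smallLoad b = load-itms (All.filter⁺ (λ p → classOf p ≟ b) valid)

      classSmall : ∀ b → weight (filter (λ p → classOf p ≟ b) P) ≤ classWeight (nth (good ++ rest) b)
      classSmall b = weight-filter-mono (λ p → classOf p ≟ b) (λ p → col p ∈? nth (good ++ rest) b) P
                       λ { p∈ refl → in-class p∈ }

      -- The bin of a good class receives at most `classWeight` of tiny items and one large item of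
      -- the complementary weight, whose color belongs to the class. Any other bin receives tiny
      -- items of at most one class.
      packs : PacksInto t input (length (good ++ rest))
      packs = labels , lengths , bounded , feasible
        where
        lengths : length labels ≡ length input
        lengths = trans (length-++ (map classOf P)) (trans (cong₂ _+_ (trans (length-map classOf P) (sym (length-map itm P)))
          (trans (length-labelsFrom 0 good) (sym (length-map big good)))) (sym (length-++ (map itm P))))
        bounded : All (_< length (good ++ rest)) labels
        bounded = All.++⁺ (All.map⁺ (All.tabulate λ p∈ → proj₂ (position-correct (good ++ rest) (covers p∈))))
          (All.map (λ h → ≤-trans h (subst (length good ≤_) (sym (length-++ good)) (m≤m+n _ _))) (labelsFrom< 0 good))
        feasible : Feasible t (zip input labels)
        feasible b with bigPacking-at 0 good b
        ... | inj₁ eq = subst (λ c → load c ℚ.≤ 1ℚ) (sym contents)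
                          (subst (ℚ._≤ 1ℚ) (sym (smallLoad b)) (fr≤1 (≤-trans (classSmall b) (<⇒≤ (classWeight<W _))))) ,
                        subst (λ c → numColors c ≤ t) (sym contents)
                          (≤-trans (distinct≤length sub) (nth-All z≤n sizes b))
          where
          contents : binContents (zip input labels) b ≡ map itm (filter (λ p → classOf p ≟ b) P)
          contents = trans (contents-labels b) (trans (cong (map itm (filter (λ p → classOf p ≟ b) P) ++_) eq) (++-identityʳ _))
          sub : map color (map itm (filter (λ p → classOf p ≟ b) P)) ⊆ nth (good ++ rest) b
          sub c∈ with ∈-map⁻ color c∈
          ... | _ , x∈ , refl with ∈-map⁻ itm x∈
          ...   | p , p∈ , refl = inClass b p∈
        ... | inj₂ (_ , refl , h , eq) = subst (λ c → load c ℚ.≤ 1ℚ) (sym contents) loadOK ,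
                        subst (λ c → numColors c ≤ t) (sym contents)
                          (≤-trans (distinct≤length sub) (nth-All z≤n sizes b))
          where
          G = nth good b
          same : nth (good ++ rest) b ≡ G
          same = nth-++ good h
          contents : binContents (zip input labels) b ≡ map itm (filter (λ p → classOf p ≟ b) P) ++ [ big G ]
          contents = trans (contents-labels b) (cong (map itm (filter (λ p → classOf p ≟ b) P) ++_) eq)
          loadOK : load (map itm (filter (λ p → classOf p ≟ b) P) ++ [ big G ]) ℚ.≤ 1ℚ
          loadOK = subst (ℚ._≤ 1ℚ) (sym (trans (load-++ (map itm (filter (λ p → classOf p ≟ b) P)) [ big G ])
            (trans (cong₂ ℚ._+_ (smallLoad b) (trans (ℚ.+-identityʳ (size (big G))) (size-big G))) (fr-+ (weight (filter (λ p → classOf p ≟ b) P)) (W ∸ classWeight G)))))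
            (fr≤1 (≤-trans (+-monoˡ-≤ (W ∸ classWeight G) (subst (λ C → weight (filter (λ p → classOf p ≟ b) P) ≤ classWeight C) same (classSmall b)))
              (≤-reflexive (m+[n∸m]≡n (<⇒≤ (classWeight<W G))))))
          sub : map color (map itm (filter (λ p → classOf p ≟ b) P) ++ [ big G ]) ⊆ nth (good ++ rest) b
          sub c∈ with ∈-map⁻ color c∈
          ... | _ , x∈ , refl with ∈-++⁻ (map itm (filter (λ p → classOf p ≟ b) P)) x∈
          ...   | inj₂ (here refl) = subst (lead G ∈_) (sym same) (nth-lead good led h)
            where
            nth-lead : ∀ gs → All (λ G → lead G ∈ G) gs → ∀ {j} → j < length gs → lead (nth gs j) ∈ nth gs j
            nth-lead (G ∷ gs) (l ∷ ls) {zero}  _       = l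
            nth-lead (G ∷ gs) (l ∷ ls) {suc j} (s≤s h) = nth-lead gs ls h
          ...   | inj₁ x∈s with ∈-map⁻ itm x∈s
          ...     | p , p∈ , refl = inClass b p∈

-- Adaptive phases

module Phases {t : ℕ} (alg : OnlineAlg t) (D B′ : ℕ) where

  open Fractions D
  open Game alg D B′

  -- The exponent is the midpoint of the current interval, whose length is twice `2 ^ length cs`;
  -- `cs` are the colors that come after `c`.
  next : List Item → ℕ → ℕ → List ℕ → Placed
  next seen lo c cs = placed e c (A seen (mk (B ^ e) c))
    where e = lo + 2 ^ length cs

  -- Phase seen T lo cs out N O: after the items seen, one item of each color in cs is presented and placed as in out.
  -- N collects the items opening a bin outside T and not used before in this phase, O the other ones.
  -- Exponents are found by bisecting (lo , lo + 2 ^ length cs): later exponents are smaller after an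
  -- item of N and larger after an item of O.
  data Phase : List Item → List ℕ → ℕ → List ℕ → (out N O : List Placed) → Set where
    []  : ∀ {seen T lo} → Phase seen T lo [] [] [] []
    old : ∀ {seen T lo c cs out N O} → let p = next seen lo c cs in bin p ∈ T →
          Phase (seen ++ [ itm p ]) T (expo p) cs out N O → Phase seen T lo (c ∷ cs) (p ∷ out) N (p ∷ O)
    new : ∀ {seen T lo c cs out N O} → let p = next seen lo c cs in bin p ∉ T →
          Phase (seen ++ [ itm p ]) (bin p ∷ T) lo cs out N O → Phase seen T lo (c ∷ cs) (p ∷ out) (p ∷ N) O

  play : ∀ seen T lo cs → ∃[ out ] ∃[ N ] ∃[ O ] Phase seen T lo cs out N O
  play seen T lo []       = _ , _ , _ , []
  play seen T lo (c ∷ cs) with bin (next seen lo c cs) ∈? T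
  ... | yes β∈ = let _ , _ , _ , ph = play _ T _ cs in _ , _ , _ , old β∈ ph
  ... | no  β∉ = let _ , _ , _ , ph = play _ _ lo cs in _ , _ , _ , new β∉ ph

  executes : ∀ {seen T lo cs out N O} → Phase seen T lo cs out N O → runFrom A seen (map itm out) ≡ map place out
  executes []         = refl
  executes (old _ ph) = cong (_ ∷_) (executes ph)
  executes (new _ ph) = cong (_ ∷_) (executes ph)

  phase-colors : ∀ {seen T lo cs out N O} → Phase seen T lo cs out N O → map col out ≡ cs
  phase-colors []         = refl
  phase-colors (old _ ph) = cong (_ ∷_) (phase-colors ph)
  phase-colors (new _ ph) = cong (_ ∷_) (phase-colors ph)

  N⊆out : ∀ {seen T lo cs out N O} → Phase seen T lo cs out N O → N ⊆ out
  N⊆out (old _ ph) x∈          = there (N⊆out ph x∈)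
  N⊆out (new _ ph) (here refl) = here refl
  N⊆out (new _ ph) (there x∈)  = there (N⊆out ph x∈)

  O⊆out : ∀ {seen T lo cs out N O} → Phase seen T lo cs out N O → O ⊆ out
  O⊆out (old _ ph) (here refl) = here refl
  O⊆out (old _ ph) (there x∈)  = there (O⊆out ph x∈)
  O⊆out (new _ ph) x∈          = there (O⊆out ph x∈)

  O-colors-unique : ∀ {seen T lo cs out N O} → Phase seen T lo cs out N O → Unique cs → Unique (map col O)
  O-colors-unique []         _        = []
  O-colors-unique (old _ ph) (c∉ ∷ u) = All.¬Any⇒All¬ _ (λ c∈ → case ∈-map⁻ col c∈ of λ (p , p∈ , eq) →
    All.lookup c∉ (subst (col p ∈_) (phase-colors ph) (∈-map⁺ col (O⊆out ph p∈))) eq) ∷ O-colors-unique ph u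
  O-colors-unique (new _ ph) (_ ∷ u)  = O-colors-unique ph u

  out⊆N∪O : ∀ {seen T lo cs out N O} → Phase seen T lo cs out N O → ∀ {x} → x ∈ out → x ∈ N ⊎ x ∈ O
  out⊆N∪O (old _ ph) (here refl) = inj₂ (here refl)
  out⊆N∪O (old _ ph) (there x∈)  = Sum.map₂ there (out⊆N∪O ph x∈)
  out⊆N∪O (new _ ph) (here refl) = inj₁ (here refl)
  out⊆N∪O (new _ ph) (there x∈)  = Sum.map₁ there (out⊆N∪O ph x∈)

  length-N+O : ∀ {seen T lo cs out N O} → Phase seen T lo cs out N O → length N + length O ≡ length cs
  length-N+O []         = refl
  length-N+O (old _ ph) = trans (+-suc _ _) (cong suc (length-N+O ph))
  length-N+O (new _ ph) = cong suc (length-N+O ph)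

  Within : ℕ → ℕ → Placed → Set
  Within lo n p = lo < expo p × expo p < lo + 2 ^ n

  phase-bounds : ∀ {seen T lo cs out N O} → Phase seen T lo cs out N O → All (Within lo (length cs)) out
  phase-bounds []         = []
  phase-bounds {lo = lo} {cs = _ ∷ cs} (old _ ph) =
    (m<m+n lo (m^n>0 2 (length cs)) , +-monoʳ-< lo (m<m+n (2 ^ length cs) (≤-trans (m^n>0 2 (length cs)) (m≤m+n _ _)))) ∷
    All.map (λ (a , b) → ≤-<-trans (m≤m+n lo _) a ,
      <-≤-trans b (≤-reflexive (trans (+-assoc lo _ _) (cong (λ n → lo + (2 ^ length cs + n)) (sym (+-identityʳ _)))))) (phase-bounds ph)
  phase-bounds {lo = lo} {cs = _ ∷ cs} (new _ ph) =
    (m<m+n lo (m^n>0 2 (length cs)) , +-monoʳ-< lo (m<m+n (2 ^ length cs) (≤-trans (m^n>0 2 (length cs)) (m≤m+n _ _)))) ∷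
    All.map (λ (a , b) → a , <-≤-trans b (+-monoʳ-≤ lo (m≤m+n _ _))) (phase-bounds ph)

  -- Whichever of the two comes first separates them: it is the midpoint, and the later item lies in
  -- the upper half after an item of `O` and in the lower half after an item of `N`.
  O<N : ∀ {seen T lo cs out N O} → Phase seen T lo cs out N O → ∀ {x y} → x ∈ O → y ∈ N → expo x < expo y
  O<N (old _ ph) (here refl) y∈          = proj₁ (All.lookup (phase-bounds ph) (N⊆out ph y∈))
  O<N (old _ ph) (there x∈)  y∈          = O<N ph x∈ y∈
  O<N (new _ ph) x∈          (here refl) = proj₂ (All.lookup (phase-bounds ph) (O⊆out ph x∈))
  O<N (new _ ph) x∈          (there y∈)  = O<N ph x∈ y∈

  -- An opened bin joins `T`, so the second component, freshness with respect to `T`, carries the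
  -- distinctness of bins through the induction.
  N-pairs : ∀ {seen T lo cs out N O} → Phase seen T lo cs out N O →
            AllPairs (λ x y → expo y < expo x × bin x ≢ bin y) N × All (λ x → bin x ∉ T) N
  N-pairs []         = [] , []
  N-pairs (old _ ph) = N-pairs ph
  N-pairs {T = T} (new β∉ ph) with N-pairs ph
  ... | ps , fresh =
    (All.tabulate (λ y∈ → proj₂ (All.lookup (phase-bounds ph) (N⊆out ph y∈)) ,
                          λ eq → All.lookup fresh y∈ (here (sym eq))) ∷ ps) ,
    β∉ ∷ All.map (λ f → f ∘ there) fresh

  out-bins : ∀ {seen T lo cs out N O} → Phase seen T lo cs out N O → ∀ {x} → x ∈ out → bin x ∈ T ⊎ bin x ∈ map bin N
  out-bins (old β∈ ph) (here refl) = inj₁ β∈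
  out-bins (old _ ph)  (there x∈)  = out-bins ph x∈
  out-bins (new _ ph)  (here refl) = inj₂ (here refl)
  out-bins (new _ ph)  (there x∈) with out-bins ph x∈
  ... | inj₁ (here eq)  = inj₂ (here eq)
  ... | inj₁ (there β∈) = inj₁ β∈
  ... | inj₂ β∈         = inj₂ (there β∈)

  out-colors-at : ∀ {out} → run A (map itm out) ≡ map place out →
                  ∀ {p} → p ∈ out → col p ∈ map color (binContents (run A (map itm out)) (bin p))
  out-colors-at {out} exec {p} p∈ rewrite exec = ∈-map⁺ color (∈-binContents (∈-map⁺ place p∈))

-- The final attack with large items

lead∈ : ∀ {G n} → length G ≡ suc n → lead G ∈ G
lead∈ {_ ∷ _} _ = here refl

module _ {v : ℕ} (alg : OnlineAlg (2 + v)) (D B′ : ℕ) where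

  open Fractions D
  open Game alg D B′
  open Phases alg D B′

  private
    t : ℕ
    t = 2 + v

  -- The bins of the items in F are full: x is the largest item of its bin and os x are the t - 1 others.
  -- The phase presents the colors outside the full bins once more, above the exponents of out₁.
  module Attack
    (m lo H : ℕ) (out₁ F : List Placed) (os : Placed → List Placed)
    (exec₁ : run A (map itm out₁) ≡ map place out₁)
    (below : All (λ p → expo p ≤ lo) out₁)
    (F⊆ : F ⊆ out₁)
    (os⊆ : ∀ {x y} → x ∈ F → y ∈ os x → y ∈ out₁ × bin y ≡ bin x × expo y < expo x)
    (os-length : ∀ {x} → x ∈ F → length (os x) ≡ suc v)
    (os-unique : ∀ {x} → x ∈ F → Unique (map col (x ∷ os x)))
    (F-pairs : AllPairs (λ x y → expo y < expo x × bin x ≢ bin y) F)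
    (owner : ∀ {p q} → p ∈ out₁ → q ∈ out₁ → col p ≡ col q → p ≡ q)
    {cs : List ℕ} (cs-unique : Unique cs)
    (cs-free : ∀ {x y} → x ∈ F → y ∈ x ∷ os x → col y ∉ cs)
    (cover₁ : ∀ {p} → p ∈ out₁ → col p ∈ cs ⊎ ∃[ x ] x ∈ F × p ∈ x ∷ os x)
    (colors₁ : map col out₁ ⊆ upTo (t * m)) (colors₂ : cs ⊆ upTo (t * m)) (colors : upTo (t * m) ⊆ map col out₁ ++ cs)
    {out N O : List Placed} (phase : Phase (map itm out₁) [] lo cs out N O)
    (low : All (λ p → expo p < H) (out₁ ++ out)) (short : length (out₁ ++ out) ≤ B′) (room : B ^ H + B ^ H ≤ W)
    where

    P : List Placed
    P = out₁ ++ out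

    exec : run A (map itm P) ≡ map place P
    exec = begin
      run A (map itm P)                                                  ≡⟨ cong (run A) (map-++ itm out₁ out) ⟩
      run A (map itm out₁ ++ map itm out)                                ≡⟨ runFrom-++ A [] (map itm out₁) (map itm out) ⟩
      run A (map itm out₁) ++ runFrom A (map itm out₁) (map itm out)     ≡⟨ cong₂ _++_ exec₁ (executes phase) ⟩
      map place out₁ ++ map place out                                    ≡⟨ map-++ place out₁ out ⟨
      map place P                                                        ∎
      where open ≡-Reasoning

    palette : Placed → List ℕ
    palette x = map col (x ∷ os x)

    group : ∀ {x} → x ∈ F → ∀ {y} → y ∈ x ∷ os x → y ∈ out₁ × bin y ≡ bin x
    group x∈ (here refl) = F⊆ x∈ , refl
    group x∈ (there y∈)  = let y∈₁ , eq , _ = os⊆ x∈ y∈ in y∈₁ , eq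

    out-color : ∀ {p} → p ∈ out → col p ∈ cs
    out-color p∈ = subst (_ ∈_) (phase-colors phase) (∈-map⁺ col p∈)

    out-owner : ∀ {p q} → p ∈ out → q ∈ out → col p ≡ col q → p ≡ q
    out-owner = unique-map⇒injective (subst Unique (sym (phase-colors phase)) cs-unique)

    group-color∉cs : ∀ {x c} → x ∈ F → c ∈ palette x → c ∉ cs
    group-color∉cs x∈ c∈ with ∈-map⁻ col c∈
    ... | y , y∈ , refl = cs-free x∈ y∈

    -- By `owner` a common color would come from one and the same item, which lies in only one bin.
    palettes-disjoint : ∀ {x z c} → x ∈ F → z ∈ F → bin x ≢ bin z → c ∈ palette x → c ∉ palette z
    palettes-disjoint x∈ z∈ x≢z c∈ c∈′ with ∈-map⁻ col c∈ | ∈-map⁻ col c∈′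
    ... | y , y∈ , refl | y′ , y′∈ , eq with owner (proj₁ (group x∈ y∈)) (proj₁ (group z∈ y′∈)) eq
    ...   | refl = x≢z (trans (sym (proj₂ (group x∈ y∈))) (proj₂ (group z∈ y′∈)))

    -- A partition of the t * m colors. It is counted once for `total`, which relates `cs` to the
    -- number of full bins, and once more to bound the optimum from below.
    allColors : List ℕ
    allColors = cs ++ concat (map palette F)

    allColors-unique : Unique allColors
    allColors-unique = Unique.++⁺ cs-unique
      (Unique.concat⁺ (All.map⁺ (All.tabulate os-unique)) (AllPairs.map⁺ (pairwise F id F-pairs))) disj
      where
      pairwise : ∀ xs → xs ⊆ F → AllPairs (λ x y → expo y < expo x × bin x ≢ bin y) xs →
                 AllPairs (λ x y → Disjoint (palette x) (palette y)) xs
      pairwise []       s []       = []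
      pairwise (x ∷ xs) s (p ∷ ps) =
        All.tabulate (λ y∈ (c∈x , c∈y) → palettes-disjoint (s (here refl)) (s (there y∈)) (proj₂ (All.lookup p y∈)) c∈x c∈y) ∷
        pairwise xs (s ∘ there) ps
      disj : Disjoint cs (concat (map palette F))
      disj (c∈ , c∈F) with ∈-concat⁻′ (map palette F) c∈F
      ... | _ , c∈x , x∈ with ∈-map⁻ palette x∈
      ...   | x , x∈F , refl = group-color∉cs x∈F c∈x c∈

    allColors⊆upTo : allColors ⊆ upTo (t * m)
    allColors⊆upTo c∈ with ∈-++⁻ cs c∈
    ... | inj₁ c∈cs = colors₂ c∈cs
    ... | inj₂ c∈F with ∈-concat⁻′ (map palette F) c∈F
    ...   | _ , c∈x , x∈ with ∈-map⁻ palette x∈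
    ...     | x , x∈F , refl with ∈-map⁻ col c∈x
    ...       | y , y∈ , refl = colors₁ (∈-map⁺ col (proj₁ (group x∈F y∈)))

    upTo⊆allColors : upTo (t * m) ⊆ allColors
    upTo⊆allColors c∈ with ∈-++⁻ (map col out₁) (colors c∈)
    ... | inj₂ c∈cs = ∈-++⁺ˡ c∈cs
    ... | inj₁ c∈₁ with ∈-map⁻ col c∈₁
    ...   | p , p∈ , refl with cover₁ p∈
    ...     | inj₁ c∈cs = ∈-++⁺ˡ c∈cs
    ...     | inj₂ (x , x∈ , p∈x) = ∈-++⁺ʳ cs (∈-concat⁺′ (∈-map⁺ col p∈x) (∈-map⁺ palette x∈))

    length-allColors : length allColors ≡ t * m
    length-allColors = trans (≤-antisym (unique-⊆⇒length≤ allColors-unique allColors⊆upTo)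
      (unique-⊆⇒length≤ (Unique.upTo⁺ (t * m)) upTo⊆allColors)) (length-upTo (t * m))

    palette-length : ∀ {x} → x ∈ F → length (palette x) ≡ t
    palette-length {x} x∈ = cong suc (trans (length-map col (os x)) (os-length x∈))

    total : length cs + t * length F ≡ t * m
    total = trans (cong (λ n → length cs + n) (sym (go F id))) (trans (sym (length-++ cs)) length-allColors)
      where
      go : ∀ xs → xs ⊆ F → length (concat (map palette xs)) ≡ t * length xs
      go []       s = sym (*-zeroʳ t)
      go (x ∷ xs) s = trans (length-++ (palette x)) (trans (cong₂ _+_ (palette-length (s (here refl))) (go xs (s ∘ there)))
        (sym (*-suc t (length xs))))

    -- Class i pairs the small items of the i-th full bin with the large item of the next one: by monotonicity
    -- of the large items its weight is below that of the large item of bin i, the only full bin showing its lead.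
    chain′ : Placed → List Placed → List (List ℕ)
    chain′ x []       = []
    chain′ x (y ∷ ys) = (map col (os x) ++ [ col y ]) ∷ chain′ y ys

    chain : List Placed → List (List ℕ)
    chain []       = []
    chain (x ∷ xs) = chain′ x xs

    -- The chain leaves over the small colors of the last full bin and, added in `loose`, the color
    -- of the largest item of the first one: t colors if there is a full bin.
    loose′ : Placed → List Placed → List ℕ
    loose′ x []       = map col (os x)
    loose′ x (y ∷ ys) = loose′ y ys

    loose : List Placed → List ℕ
    loose []       = []
    loose (x ∷ xs) = col x ∷ loose′ x xs

    length-chain′ : ∀ x xs → length (chain′ x xs) ≡ length xs
    length-chain′ x []       = refl
    length-chain′ x (y ∷ ys) = cong suc (length-chain′ y ys)

    length-chain : ∀ xs → length (chain xs) ≡ length xs ∸ 1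
    length-chain []       = refl
    length-chain (x ∷ xs) = length-chain′ x xs

    length-loose′ : ∀ x xs → x ∷ xs ⊆ F → length (loose′ x xs) ≡ suc v
    length-loose′ x []       s = trans (length-map col (os x)) (os-length (s (here refl)))
    length-loose′ x (y ∷ ys) s = length-loose′ y ys (s ∘ there)

    length-loose : ∀ xs → xs ⊆ F → length (loose xs) + t * length (chain xs) ≡ t * length xs
    length-loose []       s = refl
    length-loose (x ∷ xs) s rewrite length-loose′ x xs s | length-chain′ x xs = sym (*-suc t (length xs))

    -- The color of `x` is set apart because it belongs to the link that precedes `x`, or is loose
    -- if there is none.
    cover-chain′ : ∀ x xs {z c} → z ∈ x ∷ xs → c ∈ palette z → c ≡ col x ⊎ (c ∈ concat (chain′ x xs) ⊎ c ∈ loose′ x xs)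
    cover-chain′ x []       (here refl) (here refl) = inj₁ refl
    cover-chain′ x []       (here refl) (there c∈)  = inj₂ (inj₂ c∈)
    cover-chain′ x (y ∷ ys) (here refl) (here refl) = inj₁ refl
    cover-chain′ x (y ∷ ys) (here refl) (there c∈)  = inj₂ (inj₁ (∈-++⁺ˡ (∈-++⁺ˡ c∈)))
    cover-chain′ x (y ∷ ys) (there z∈)  c∈ with cover-chain′ y ys z∈ c∈
    ... | inj₁ refl      = inj₂ (inj₁ (∈-++⁺ˡ (∈-++⁺ʳ (map col (os x)) (here refl))))
    ... | inj₂ (inj₁ c∈) = inj₂ (inj₁ (∈-++⁺ʳ (map col (os x) ++ [ col y ]) c∈))
    ... | inj₂ (inj₂ c∈) = inj₂ (inj₂ c∈)

    cover-chain : ∀ xs {z c} → z ∈ xs → c ∈ palette z → c ∈ concat (chain xs) ⊎ c ∈ loose xs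
    cover-chain (x ∷ xs) z∈ c∈ with cover-chain′ x xs z∈ c∈
    ... | inj₁ refl      = inj₂ (here refl)
    ... | inj₂ (inj₁ c∈) = inj₁ c∈
    ... | inj₂ (inj₂ c∈) = inj₂ (there c∈)

    Link : List ℕ → Set
    Link G = ∃[ x ] ∃[ y ] x ∈ F × y ∈ F × expo y < expo x × G ≡ map col (os x) ++ [ col y ]

    chain′-links : ∀ x xs → x ∷ xs ⊆ F → AllPairs (λ x y → expo y < expo x × bin x ≢ bin y) (x ∷ xs) → All Link (chain′ x xs)
    chain′-links x []       s _                        = []
    chain′-links x (y ∷ ys) s (((y<x , _) ∷ _) ∷ pairs) =
      (x , y , s (here refl) , s (there (here refl)) , y<x , refl) ∷ chain′-links y ys (s ∘ there) pairs

    chain-links : ∀ xs → xs ⊆ F → AllPairs (λ x y → expo y < expo x × bin x ≢ bin y) xs → All Link (chain xs)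
    chain-links []       _ _ = []
    chain-links (x ∷ xs) s p = chain′-links x xs s p

    link-length : ∀ {G} → Link G → length G ≡ t
    link-length (x , y , x∈ , _ , _ , refl) = trans (length-++ (map col (os x)))
      (trans (cong (_+ 1) (trans (length-map col (os x)) (os-length x∈))) (+-comm (suc v) 1))

    -- Here t ≥ 2 matters: a full bin has t - 1 ≥ 1 small items, so a link begins with one of their
    -- colors.
    link-lead : ∀ {G} → ((x , _) : Link G) → ∃[ o ] o ∈ os x × lead G ≡ col o
    link-lead (x , y , x∈ , _ , _ , refl) with os x | os-length x∈
    ... | o ∷ _ | _ = o , here refl , refl

    q : ℕ
    q = length O ℕ./ t

    oldChunks : List (List ℕ)
    oldChunks = chunks t q (map col O)

    good : List (List ℕ)
    good = chain F ++ oldChunks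

    restColors : List ℕ
    restColors = loose F ++ drop (q * t) (map col O) ++ map col N

    rest : List (List ℕ)
    rest = chunks t (m ∸ length good) restColors

    length-good : length good ≡ (length F ∸ 1) + q
    length-good = trans (length-++ (chain F)) (cong₂ _+_ (length-chain F) (length-chunks t q (map col O)))

    q*t≤ : q * t ≤ length (map col O)
    q*t≤ = ≤-trans (ℕ.m/n*n≤m (length O) t) (≤-reflexive (sym (length-map col O)))

    -- Good classes have exactly t colors each, so the colors left over fill exactly the remaining
    -- `m ∸ length good` classes.
    length-all : length restColors + length good * t ≡ m * t
    length-all = begin
      length restColors + length good * t
        ≡⟨ cong₂ _+_ (trans (length-++ (loose F)) (cong (λ n → length (loose F) + n)
             (trans (length-++ (drop (q * t) (map col O))) (cong₂ _+_ (trans (length-drop (q * t) (map col O)) (cong (_∸ q * t) (length-map col O))) (length-map col N)))))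
             (cong (_* t) (trans (length-++ (chain F)) (cong (λ n → length (chain F) + n) (length-chunks t q (map col O))))) ⟩
      length (loose F) + (length O ∸ q * t + length N) + (length (chain F) + q) * t
        ≡⟨ shuffle (length (loose F)) (length O ∸ q * t) (length N) (length (chain F)) ⟩
      length (loose F) + t * length (chain F) + (length N + (q * t + (length O ∸ q * t)))
        ≡⟨ cong₂ _+_ (length-loose F id) (cong (λ n → length N + n) (m+[n∸m]≡n (ℕ.m/n*n≤m (length O) t))) ⟩
      t * length F + (length N + length O)   ≡⟨ cong (λ n → t * length F + n) (length-N+O phase) ⟩
      t * length F + length cs               ≡⟨ +-comm (t * length F) (length cs) ⟩
      length cs + t * length F               ≡⟨ total ⟩
      t * m                                  ≡⟨ *-comm t m ⟩
      m * t                                  ∎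
      where
      open ≡-Reasoning
      regroup : ∀ t l o n c r → l + (o + n) + (c * t + r) ≡ l + t * c + (n + (r + o))
      regroup = solve-∀
      shuffle : ∀ l o n c → l + (o + n) + (c + q) * t ≡ l + t * c + (n + (q * t + o))
      shuffle l o n c = trans (cong (λ k → l + (o + n) + k) (*-distribʳ-+ t c q)) (regroup t l o n c (q * t))

    good≤m : length good ≤ m
    good≤m = *-cancelʳ-≤ (length good) m t (≤-trans (m≤n+m _ (length restColors)) (≤-reflexive length-all))

    restColors≤ : length restColors ≤ (m ∸ length good) * t
    restColors≤ = ≤-reflexive (sym (trans (*-distribʳ-∸ t m (length good))
      (trans (cong (_∸ length good * t) (sym length-all)) (m+n∸n≡m (length restColors) (length good * t)))))

    length-classes : length (good ++ rest) ≡ m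
    length-classes = trans (length-++ good)
      (trans (cong (λ n → length good + n) (length-chunks t (m ∸ length good) restColors)) (m+[n∸m]≡n good≤m))

    good-length : All (λ G → length G ≡ t) good
    good-length = All.++⁺ (All.map link-length (chain-links F id F-pairs)) (chunks-length≡ t q (map col O) q*t≤)

    restCover : ∀ {c} → c ∈ restColors → c ∈ concat (good ++ rest)
    restCover c∈ = subst (_ ∈_) (concat-++ good rest) (∈-++⁺ʳ (concat good) (case ∈-chunks t (m ∸ length good) c∈ of λ where
      (inj₁ c∈rest) → c∈rest
      -- By `restColors≤` nothing lies beyond the last of these classes.
      (inj₂ c∈drop) → case subst (_ ∈_) (drop-all ((m ∸ length good) * t) restColors restColors≤) c∈drop of λ ()))

    goodCover : ∀ {c} → c ∈ concat (chain F) ⊎ c ∈ concat oldChunks → c ∈ concat (good ++ rest)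
    goodCover c∈ = subst (_ ∈_) (concat-++ good rest) (∈-++⁺ˡ (subst (_ ∈_) (concat-++ (chain F) oldChunks)
      (case c∈ of λ where
        (inj₁ c∈) → ∈-++⁺ˡ c∈
        (inj₂ c∈) → ∈-++⁺ʳ (concat (chain F)) c∈)))

    cs-cover : ∀ {c} → c ∈ cs → c ∈ concat (good ++ rest)
    cs-cover c∈ with ∈-map⁻ col (subst (_ ∈_) (sym (phase-colors phase)) c∈)
    ... | p , p∈ , refl with out⊆N∪O phase p∈
    ...   | inj₁ p∈N = restCover (∈-++⁺ʳ (loose F) (∈-++⁺ʳ (drop (q * t) (map col O)) (∈-map⁺ col p∈N)))
    ...   | inj₂ p∈O with ∈-chunks t q (∈-map⁺ col p∈O)
    ...     | inj₁ c∈ = goodCover (inj₂ c∈)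
    ...     | inj₂ c∈ = restCover (∈-++⁺ʳ (loose F) (∈-++⁺ˡ c∈))

    covers : ∀ {p} → p ∈ P → col p ∈ concat (good ++ rest)
    covers p∈ with ∈-++⁻ out₁ p∈
    ... | inj₂ p∈out = cs-cover (out-color p∈out)
    ... | inj₁ p∈₁ with cover₁ p∈₁
    ...   | inj₁ c∈ = cs-cover c∈
    ...   | inj₂ (x , x∈ , p∈x) with cover-chain F x∈ (∈-map⁺ col p∈x)
    ...     | inj₁ c∈ = goodCover (inj₁ c∈)
    ...     | inj₂ c∈ = restCover (∈-++⁺ˡ c∈)

    open Finale P exec low short room good rest public

    -- The phase works at a scale above `lo`. This also disposes of the earlier items whose colors
    -- are presented again.
    above-out₁ : ∀ {n} → n ∈ N → ∀ {p} → p ∈ out₁ → expo p < expo n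
    above-out₁ n∈ p∈ = ≤-<-trans (All.lookup below p∈) (proj₁ (All.lookup (phase-bounds phase) (N⊆out phase n∈)))

    palette-shown : ∀ {x} → x ∈ F → All (λ d → ∃[ y ] y ∈ P × bin y ≡ bin x × col y ≡ d) (palette x)
    palette-shown x∈ = All.map⁺ (All.tabulate λ y∈ → _ , ∈-++⁺ˡ (proj₁ (group x∈ y∈)) , proj₂ (group x∈ y∈) , refl)

    -- There are three kinds of bins. The bin of `x` is blocked by `x` itself, since `y` and the
    -- small items are lighter. Another full bin shows t colors without the lead. A bin touched in
    -- the phase holds an item heavier than all of `out₁`, and the colors of the link are not
    -- presented again.
    blocked-link : ∀ {G β} → Link G → β ∈ map bin F ⊎ β ∈ map bin N → Blocked G β
    blocked-link l@(x , y , x∈ , y∈ , y<x , refl) (inj₁ β∈) with ∈-map⁻ bin β∈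
    ... | z , z∈ , refl with bin x ≟ bin z
    ...   | yes x≡z = overload (∈-++⁺ˡ (F⊆ x∈)) x≡z lighter
      where
      lighter : ∀ {p} → p ∈ P → col p ∈ map col (os x) ++ [ col y ] → expo p < expo x
      lighter p∈ c∈ with ∈-++⁻ out₁ p∈ | ∈-++⁻ (map col (os x)) c∈
      ... | inj₁ p∈₁  | inj₁ c∈x = case ∈-map⁻ col c∈x of λ (o , o∈ , eq) →
        let o∈₁ , _ , o<x = os⊆ x∈ o∈ in subst (λ p → expo p < expo x) (sym (owner p∈₁ o∈₁ eq)) o<x
      ... | inj₁ p∈₁  | inj₂ (here eq) = subst (λ p → expo p < expo x) (sym (owner p∈₁ (F⊆ y∈) eq)) y<x
      ... | inj₂ p∈out | inj₁ c∈x = ⊥-elim (group-color∉cs x∈ (there c∈x) (out-color p∈out))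
      ... | inj₂ p∈out | inj₂ (here eq) = ⊥-elim (group-color∉cs y∈ (here eq) (out-color p∈out))
    ...   | no x≢z = saturated (os-unique z∈) (palette-length z∈) (palette-shown z∈)
      λ c∈ → let o , o∈ , eq = link-lead l in
        palettes-disjoint x∈ z∈ x≢z (subst (_∈ palette x) (sym eq) (there (∈-map⁺ col o∈))) c∈
    blocked-link (x , y , x∈ , y∈ , y<x , refl) (inj₂ β∈) with ∈-map⁻ bin β∈
    ... | n , n∈ , refl = overload (∈-++⁺ʳ out₁ (N⊆out phase n∈)) refl lighter
      where
      lighter : ∀ {p} → p ∈ P → col p ∈ map col (os x) ++ [ col y ] → expo p < expo n
      lighter p∈ c∈ with ∈-++⁻ out₁ p∈ | ∈-++⁻ (map col (os x)) c∈
      ... | inj₁ p∈₁   | _ = above-out₁ n∈ p∈₁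
      ... | inj₂ p∈out | inj₁ c∈x = ⊥-elim (group-color∉cs x∈ (there c∈x) (out-color p∈out))
      ... | inj₂ p∈out | inj₂ (here eq) = ⊥-elim (group-color∉cs y∈ (here eq) (out-color p∈out))

    -- Full bins show only colors outside `cs`. In a bin touched in the phase, the first item
    -- outweighs the items of `O` by `O<N` and the earlier items by its scale.
    blocked-old : ∀ {G β} → length G ≡ t → G ⊆ map col O → β ∈ map bin F ⊎ β ∈ map bin N → Blocked G β
    blocked-old {G} len G⊆ (inj₁ β∈) with ∈-map⁻ bin β∈
    ... | z , z∈ , refl = saturated (os-unique z∈) (palette-length z∈) (palette-shown z∈)
      λ c∈ → case ∈-map⁻ col (G⊆ (lead∈ len)) of λ (o , o∈ , eq) →
        group-color∉cs z∈ c∈ (subst (_∈ cs) (sym eq) (out-color (O⊆out phase o∈)))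
    blocked-old {G} len G⊆ (inj₂ β∈) with ∈-map⁻ bin β∈
    ... | n , n∈ , refl = overload (∈-++⁺ʳ out₁ (N⊆out phase n∈)) refl lighter
      where
      lighter : ∀ {p} → p ∈ P → col p ∈ G → expo p < expo n
      lighter p∈ c∈ with ∈-++⁻ out₁ p∈ | ∈-map⁻ col (G⊆ c∈)
      ... | inj₁ p∈₁   | _            = above-out₁ n∈ p∈₁
      ... | inj₂ p∈out | o , o∈ , eq =
        subst (λ p → expo p < expo n) (sym (out-owner p∈out (O⊆out phase o∈) eq)) (O<N phase o∈ n∈)

    blocked : ∀ {G β} → G ∈ good → β ∈ map bin F ++ map bin N → Blocked G β
    blocked {G} G∈ β∈ with ∈-++⁻ (chain F) G∈
    ... | inj₁ G∈c = blocked-link (All.lookup (chain-links F id F-pairs) G∈c) (∈-++⁻ (map bin F) β∈)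
    ... | inj₂ G∈o = blocked-old {G} (All.lookup (chunks-length≡ t q (map col O) q*t≤) G∈o)
      (All.lookup (chunks-⊆ t q (map col O)) G∈o) (∈-++⁻ (map bin F) β∈)

    -- A color outside a full bin cannot be added to it.
    full-untouched : Disjoint (map bin F) (map bin N)
    full-untouched (β∈F , β∈N) with ∈-map⁻ bin β∈F | ∈-map⁻ bin β∈N
    ... | x , x∈ , refl | n , n∈ , eq = 1+n≰n (subst (λ k → suc k ≤ t) (palette-length x∈)
          (colors≤ {Q = run A (map itm P)} {ds = col n ∷ palette x} (proj₂ alg (map itm P))
            (All.¬Any⇒All¬ _ (λ c∈ → group-color∉cs x∈ c∈ (out-color (N⊆out phase n∈))) ∷ os-unique x∈) shown))
      where
      shown : col n ∷ palette x ⊆ map color (binContents (run A (map itm P)) (bin x))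
      shown (here refl) = subst (λ β → col n ∈ map color (binContents (run A (map itm P)) β)) (sym eq)
        (out-colors-at exec (∈-++⁺ʳ out₁ (N⊆out phase n∈)))
      shown (there d∈) with All.lookup (palette-shown x∈) d∈
      ... | y , y∈ , yx , refl = subst (λ β → col y ∈ map color (binContents (run A (map itm P)) β)) yx (out-colors-at exec y∈)

    used-unique : Unique (map bin F ++ map bin N)
    used-unique = Unique.++⁺ (AllPairs.map⁺ (AllPairs.map proj₂ F-pairs))
      (AllPairs.map⁺ (AllPairs.map proj₂ (proj₁ (N-pairs phase)))) full-untouched

    used⊆ : map bin F ++ map bin N ⊆ map bin P
    used⊆ β∈ with ∈-++⁻ (map bin F) β∈
    ... | inj₁ β∈F = case ∈-map⁻ bin β∈F of λ { (x , x∈ , refl) → ∈-map⁺ bin (∈-++⁺ˡ (F⊆ x∈)) }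
    ... | inj₂ β∈N = case ∈-map⁻ bin β∈N of λ { (n , n∈ , refl) → ∈-map⁺ bin (∈-++⁺ʳ out₁ (N⊆out phase n∈)) }

    cost≥ : (length F + length N) + ((length F ∸ 1) + q) ≤ cost alg input
    cost≥ = ≤-trans (≤-reflexive (cong₂ _+_
      (sym (trans (length-++ (map bin F)) (cong₂ _+_ (length-map bin F) (length-map bin N)))) (sym length-good)))
      (cost-bound used-unique used⊆ blocked)

    -- The phase starts with no known bins, so each of its items lies in the bin of some item of
    -- `N`, and such a bin shows at most t colors.
    cs≤ : length cs ≤ t * length N
    cs≤ = begin
      length cs                              ≤⟨ unique-⊆⇒length≤ cs-unique sub ⟩
      length (concat (map shown N))          ≤⟨ length-concat≤ t (All.map⁺ (All.universal (λ n → proj₂ (proj₂ alg (map itm P) (bin n))) N)) ⟩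
      t * length (map shown N)               ≡⟨ cong (t *_) (length-map shown N) ⟩
      t * length N                           ∎
      where
      open ≤-Reasoning
      shown : Placed → List ℕ
      shown n = deduplicate _≟_ (map color (binContents (run A (map itm P)) (bin n)))
      sub : cs ⊆ concat (map shown N)
      sub c∈ with ∈-map⁻ col (subst (_ ∈_) (sym (phase-colors phase)) c∈)
      ... | p , p∈ , refl with out-bins phase p∈
      ...   | inj₂ β∈ with ∈-map⁻ bin β∈
      ...     | n , n∈ , eq = ∈-concat⁺′ (subst (λ β → col p ∈ deduplicate _≟_ (map color (binContents (run A (map itm P)) β))) eq
                                (∈-deduplicate⁺ _≟_ (out-colors-at exec (∈-++⁺ʳ out₁ p∈)))) (∈-map⁺ shown n∈)

    colors⊆input : ∀ {p} → p ∈ P → col p ∈ map color input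
    colors⊆input p∈ = ∈-map⁺ color (∈-++⁺ˡ (∈-map⁺ itm p∈))

    allColors⊆ : allColors ⊆ map color input
    allColors⊆ c∈ with ∈-++⁻ cs c∈
    ... | inj₁ c∈cs with ∈-map⁻ col (subst (_ ∈_) (sym (phase-colors phase)) c∈cs)
    ...   | p , p∈ , refl = colors⊆input (∈-++⁺ʳ out₁ p∈)
    allColors⊆ c∈ | inj₂ c∈F with ∈-concat⁻′ (map palette F) c∈F
    ... | _ , c∈x , x∈ with ∈-map⁻ palette x∈
    ...   | x , x∈F , refl with ∈-map⁻ col c∈x
    ...     | y , y∈ , refl = colors⊆input (∈-++⁺ˡ (proj₁ (group x∈F y∈)))

    opt : OptIs t input m
    opt = subst (PacksInto t input) length-classes
            (packs (All.++⁺ (All.map ≤-reflexive good-length) (chunks-length≤ t (m ∸ length good) restColors))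
                   (All.map lead∈ good-length) covers) ,
          -- All t * m colors occur in the input, so k bins with at most t colors each force m ≤ k.
          λ k k<m pk → <⇒≱ k<m (*-cancelˡ-≤ t (≤-trans (≤-reflexive (sym length-allColors))
                                  (colors≤bins pk allColors-unique allColors⊆)))

-- Arithmetic of the two cases

few-bound : ∀ {u N O q z m C} → N + O ≡ suc u * m → suc u * m ≤ u * N + z → z + z ≤ m →
            O ≤ q * suc u + suc u → N + q ≤ C → 4 * (suc u * m) ≤ 2 * (suc u * C) + 4 * suc u + m
few-bound {u} {N} {O} {q} {z} {m} {C} NO M≤ zz≤m O≤ c≤ = begin
  -- One copy of `t * m` is bounded by the colors that the bins show; the other one is `N + O`,
  -- where `O` exceeds the `q` complete classes by at most t.
  4 * (t * m)                             ≡⟨ double (t * m) ⟩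
  2 * (t * m + t * m)                     ≤⟨ *-monoʳ-≤ 2 (+-mono-≤ M≤ (≤-trans (≤-reflexive (sym NO)) (+-monoʳ-≤ N O≤))) ⟩
  -- Enlarging `2 * t` to `4 * t` gives both cases the same conclusion.
  2 * (u * N + z + (N + (q * t + t)))     ≡⟨ regroup u N z q ⟩
  2 * (t * (N + q)) + 2 * t + (z + z)     ≤⟨ +-mono-≤ (+-mono-≤ (*-monoʳ-≤ 2 (*-monoʳ-≤ t c≤)) (*-monoˡ-≤ t {2} {4} (s≤s (s≤s z≤n)))) zz≤m ⟩
  2 * (t * C) + 4 * t + m                 ∎
  where
  open ≤-Reasoning
  t = suc u
  double : ∀ a → 4 * a ≡ 2 * (a + a)
  double = solve-∀
  regroup : ∀ u N z q → 2 * (u * N + z + (N + (q * suc u + suc u))) ≡ 2 * (suc u * (N + q)) + 2 * suc u + (z + z)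
  regroup = solve-∀

-- Combines `m ≤ z + z` once, `m ≤ z + Y` taken 2(t - 1) times, and twice the equation `total`. The
-- left sides add up to 4tm - m.
many-bound : ∀ {u z Y O q c m C} → c + suc u * z ≡ suc u * m → c ≤ suc u * Y → Y + O ≡ c → O ≤ q * suc u + suc u →
             m ≤ z + z → (z + Y) + ((z ∸ 1) + q) ≤ C → 4 * (suc u * m) ≤ 2 * (suc u * C) + 4 * suc u + m
many-bound {u} {z} {Y} {O} {q} {c} {m} {C} total c≤ YO O≤ m≤ cost = +-cancelʳ-≤ (2 * t * z) _ _ (begin
  4 * (t * m) + 2 * t * z                              ≡⟨ split u m z ⟩
  (m + 2 * (u * m) + 2 * (t * m)) + m + 2 * t * z      ≤⟨ +-monoˡ-≤ (2 * t * z) (+-monoˡ-≤ m (+-mono-≤ (+-mono-≤ m≤ (*-monoʳ-≤ 2 (*-monoʳ-≤ u m≤z+Y))) (≤-reflexive (cong (2 *_) (sym total))))) ⟩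
  (z + z + 2 * (u * (z + Y)) + 2 * (c + t * z)) + m + 2 * t * z    ≡⟨ cong (λ c → (z + z + 2 * (u * (z + Y)) + 2 * (c + t * z)) + m + 2 * t * z) YO ⟨
  (z + z + 2 * (u * (z + Y)) + 2 * (Y + O + t * z)) + m + 2 * t * z
    ≤⟨ +-monoˡ-≤ (2 * t * z) (+-monoˡ-≤ m (+-monoʳ-≤ (z + z + 2 * (u * (z + Y))) (*-monoʳ-≤ 2 (+-monoˡ-≤ (t * z) (+-monoʳ-≤ Y O≤))))) ⟩
  (z + z + 2 * (u * (z + Y)) + 2 * (Y + (q * t + t) + t * z)) + m + 2 * t * z    ≡⟨ regroup u z Y q m ⟩
  2 * (t * ((z + Y) + (z + q))) + 2 * t + m + 2 * t * z ≤⟨ +-monoˡ-≤ (2 * t * z) (+-monoˡ-≤ m (+-monoˡ-≤ (2 * t) (*-monoʳ-≤ 2 (*-monoʳ-≤ t cost′)))) ⟩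
  2 * (t * suc C) + 2 * t + m + 2 * t * z              ≡⟨ finish u C m z ⟩
  2 * (t * C) + 4 * t + m + 2 * t * z                  ∎)
  where
  open ≤-Reasoning
  t = suc u
  m≤z+Y : m ≤ z + Y
  m≤z+Y = *-cancelˡ-≤ t (begin
    t * m         ≡⟨ total ⟨
    c + t * z     ≤⟨ +-monoˡ-≤ (t * z) c≤ ⟩
    t * Y + t * z ≡⟨ +-comm (t * Y) (t * z) ⟩
    t * z + t * Y ≡⟨ *-distribˡ-+ t z Y ⟨
    t * (z + Y)   ∎)
  -- The chain has one class fewer than there are full bins, which costs a further `2 * t` in the
  -- error. The bound also holds for z = 0, where the subtraction is truncated.
  cost′ : (z + Y) + (z + q) ≤ suc C
  cost′ = begin
    (z + Y) + (z + q)               ≤⟨ +-monoʳ-≤ (z + Y) (+-monoˡ-≤ q (m≤n+m∸n z 1)) ⟩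
    (z + Y) + suc ((z ∸ 1) + q)     ≡⟨ +-suc (z + Y) _ ⟩
    suc ((z + Y) + ((z ∸ 1) + q))   ≤⟨ s≤s cost ⟩
    suc C                           ∎
  split : ∀ u m z → 4 * (suc u * m) + 2 * suc u * z ≡ (m + 2 * (u * m) + 2 * (suc u * m)) + m + 2 * suc u * z
  split = solve-∀
  regroup : ∀ u z Y q m → (z + z + 2 * (u * (z + Y)) + 2 * (Y + (q * suc u + suc u) + suc u * z)) + m + 2 * suc u * z ≡
                          2 * (suc u * ((z + Y) + (z + q))) + 2 * suc u + m + 2 * suc u * z
  regroup = solve-∀
  finish : ∀ u C m z → 2 * (suc u * suc C) + 2 * suc u + m + 2 * suc u * z ≡ 2 * (suc u * C) + 4 * suc u + m + 2 * suc u * z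
  finish = solve-∀

-- Playing the adversary for a given m

module _ {v : ℕ} (alg : OnlineAlg (2 + v)) (m : ℕ) where

  private
    t u M L B′ D : ℕ
    t = 2 + v
    u = 1 + v
    M = t * m
    -- Exponents lie strictly between 0 and `L` in the first phase and between `L` and `L + L` in
    -- the second. At most `M + M` tiny items occur; the extra 1 in `B′` ensures `B` ≥ 2 even for M
    -- = 0, so that `D` is at least twice `B ^ (L + L)`.
    L = 2 ^ length (upTo M)
    B′ = suc (M + M)
    D = suc B′ * suc B′ ^ (L + L)

  open Fractions D
  open Game alg D B′
  open Phases alg D B′

  private
    room : B ^ (L + L) + B ^ (L + L) ≤ W
    room = begin
      B ^ (L + L) + B ^ (L + L)  ≡⟨ cong (λ n → B ^ (L + L) + n) (+-identityʳ (B ^ (L + L))) ⟨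
      2 * B ^ (L + L)            ≤⟨ *-monoˡ-≤ (B ^ (L + L)) {2} {B} (s≤s (s≤s z≤n)) ⟩
      D                          ≤⟨ n≤1+n D ⟩
      W                          ∎
      where open ≤-Reasoning

    unique-map-filter : {f : Placed → ℕ} {R : Pred Placed 0ℓ} (R? : Decidable R) {ps : List Placed} →
                        Unique (map f ps) → Unique (map f (filter R? ps))
    unique-map-filter R? un = AllPairs.map⁺ (AllPairs.filter⁺ R? (AllPairs.map⁻ un))

    module Play {out N O : List Placed} (phase : Phase [] [] 0 (upTo M) out N O) where

      len-out : length out ≡ M
      len-out = trans (sym (length-map col out)) (trans (cong length (phase-colors phase)) (length-upTo M))

      out-colors : map col out ⊆ upTo M
      out-colors c∈ = subst (_ ∈_) (phase-colors phase) c∈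

      out-colors-unique : Unique (map col out)
      out-colors-unique = subst Unique (sym (phase-colors phase)) (Unique.upTo⁺ M)

      owner : ∀ {p q} → p ∈ out → q ∈ out → col p ≡ col q → p ≡ q
      owner = unique-map⇒injective out-colors-unique

      low : All (λ p → expo p < L) out
      low = All.map proj₂ (phase-bounds phase)

      exec : run A (map itm out) ≡ map place out
      exec = executes phase

      os : Placed → List Placed
      os x = filter (λ y → bin y ≟ bin x) O

      -- The opening item and t - 1 others have distinct colors, so such a bin shows t colors.
      full? : Decidable (λ x → u ≤ length (os x))
      full? x = u ≤? length (os x)

      F : List Placed
      F = filter full? N

      F⊆N : F ⊆ N
      F⊆N x∈ = proj₁ (∈-filter⁻ full? x∈)

      os⊆ : ∀ {x y} → x ∈ N → y ∈ os x → y ∈ out × bin y ≡ bin x × expo y < expo x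
      os⊆ {x} x∈ y∈ = let y∈O , eq = ∈-filter⁻ (λ y → bin y ≟ bin x) y∈ in O⊆out phase y∈O , eq , O<N phase y∈O x∈

      os-unique : ∀ {x} → x ∈ N → Unique (map col (x ∷ os x))
      os-unique {x} x∈ = All.¬Any⇒All¬ _ (λ c∈ → case ∈-map⁻ col c∈ of λ (y , y∈ , eq) →
          let y∈out , _ , y<x = os⊆ x∈ y∈ in <-irrefl (cong expo (sym (owner (N⊆out phase x∈) y∈out eq))) y<x) ∷
        unique-map-filter (λ y → bin y ≟ bin x) (O-colors-unique phase (Unique.upTo⁺ M))

      os-length≤ : ∀ {x} → x ∈ N → length (os x) ≤ u
      os-length≤ {x} x∈ = s≤s⁻¹ (subst (_≤ t) (cong suc (length-map col (os x)))
        (colors≤ {Q = run A (map itm out)} (proj₂ alg (map itm out)) (os-unique x∈) shown))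
        where
        shown : map col (x ∷ os x) ⊆ map color (binContents (run A (map itm out)) (bin x))
        shown (here refl) = out-colors-at exec (N⊆out phase x∈)
        shown (there c∈) with ∈-map⁻ col c∈
        ... | y , y∈ , refl = let y∈out , yx , _ = os⊆ x∈ y∈ in
          subst (λ β → col y ∈ map color (binContents (run A (map itm out)) β)) yx (out-colors-at exec y∈out)

      opener : ∀ {p} → p ∈ out → ∀ {x} → x ∈ N → bin p ≡ bin x → p ∈ x ∷ os x
      opener p∈ {x} x∈ eq with out⊆N∪O phase p∈
      ... | inj₁ p∈N = here (unique-map⇒injective (AllPairs.map⁺ (AllPairs.map proj₂ (proj₁ (N-pairs phase)))) p∈N x∈ eq)
      ... | inj₂ p∈O = there (∈-filter⁺ (λ y → bin y ≟ bin x) p∈O eq)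

      -- Every item lies in a bin opened by an item of `N`, and a bin that is not full shows at most
      -- t - 1 colors.
      M≤ : M ≤ u * length N + length F
      M≤ = begin
        M                                                 ≡⟨ trans (length-map col out) len-out ⟨
        length (map col out)                              ≤⟨ unique-⊆⇒length≤ out-colors-unique sub ⟩
        length (concat (map (λ x → map col (x ∷ os x)) N)) ≤⟨ length-concat-split u full?
                                                               (λ {x} x∈ → s≤s (≤-trans (≤-reflexive (length-map col (os x))) (os-length≤ x∈)))
                                                               (λ {x} _ ¬f → ≤-trans (≤-reflexive (cong suc (length-map col (os x)))) (≰⇒> ¬f)) ⟩
        u * length N + length F                           ∎
        where
        open ≤-Reasoning
        sub : map col out ⊆ concat (map (λ x → map col (x ∷ os x)) N)
        sub c∈ with ∈-map⁻ col c∈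
        ... | p , p∈ , refl with out-bins phase p∈
        ...   | inj₂ β∈ with ∈-map⁻ bin β∈
        ...     | x , x∈ , eq = ∈-concat⁺′ (∈-map⁺ col (opener p∈ x∈ eq)) (∈-map⁺ (λ x → map col (x ∷ os x)) x∈)

      -- The cost is at least (2 - 1 / 2t) m - 2, cleared of denominators.
      Conclusion : Set
      Conclusion = ∃[ I ] OptIs t I m × 4 * (t * m) ≤ 2 * (t * cost alg I) + 4 * t + m

      ceil : ∀ n → n ≤ n ℕ./ t * t + t
      ceil n = ≤-trans (≤-reflexive (ℕ.m≡m%n+[m/n]*n n t))
        (≤-trans (+-monoˡ-≤ (n ℕ./ t * t) (<⇒≤ (ℕ.m%n<n n t))) (≤-reflexive (+-comm t (n ℕ./ t * t))))

      few : length F + length F ≤ m → Conclusion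
      few h = input , opt , few-bound {u} {length N} (trans (length-N+O phase) (length-upTo M)) M≤ h (ceil (length O)) cost≥
        where
        -- No earlier items and no full bins: the first phase itself serves as the phase of the
        -- attack, with all colors in `cs`.
        open Attack alg D B′ m 0 (L + L) [] [] (λ _ → []) refl [] (λ ()) (λ ()) (λ ()) (λ ()) [] (λ ())
               (Unique.upTo⁺ M) (λ ()) (λ ()) (λ ()) id id phase
               (All.map (λ {p} h → ≤-trans h (m≤m+n L L)) low) (≤-trans (≤-reflexive len-out) (m≤n⇒m≤1+n (m≤m+n M M))) room
          using (input; opt; cost≥)

      outside? : Decidable (λ p → bin p ∉ map bin F)
      outside? p = ¬? (bin p ∈? map bin F)

      cs₂ : List ℕ
      cs₂ = map col (filter outside? out)

      cs₂⊆ : cs₂ ⊆ map col out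
      cs₂⊆ c∈ with ∈-map⁻ col c∈
      ... | p , p∈ , refl = ∈-map⁺ col (proj₁ (∈-filter⁻ outside? p∈))

      cs₂⁻ : ∀ {p} → p ∈ out → col p ∈ cs₂ → bin p ∉ map bin F
      cs₂⁻ p∈ c∈ with ∈-map⁻ col c∈
      ... | p′ , p′∈ , eq with ∈-filter⁻ outside? p′∈
      ...   | p′∈out , out′ with owner p∈ p′∈out eq
      ...     | refl = out′

      cover₂ : ∀ {p} → p ∈ out → col p ∈ cs₂ ⊎ ∃[ x ] x ∈ F × p ∈ x ∷ os x
      cover₂ {p} p∈ with bin p ∈? map bin F
      ... | no β∉ = inj₁ (∈-map⁺ col (∈-filter⁺ outside? p∈ β∉))
      ... | yes β∈ with ∈-map⁻ bin β∈
      ...   | x , x∈ , eq = inj₂ (x , x∈ , opener p∈ (F⊆N x∈) eq)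

      cs₂-free : ∀ {x y} → x ∈ F → y ∈ x ∷ os x → col y ∉ cs₂
      cs₂-free x∈ (here refl) c∈ = cs₂⁻ (N⊆out phase (F⊆N x∈)) c∈ (∈-map⁺ bin x∈)
      cs₂-free x∈ (there y∈)  c∈ = let y∈out , eq , _ = os⊆ (F⊆N x∈) y∈ in
        cs₂⁻ y∈out c∈ (subst (_∈ map bin F) (sym eq) (∈-map⁺ bin x∈))

      cs₂≤M : length cs₂ ≤ M
      cs₂≤M = ≤-trans (≤-reflexive (length-map col (filter outside? out)))
                (≤-trans (length-filter outside? out) (≤-reflexive len-out))

      many : m ≤ length F + length F → Conclusion
      -- Starting from no known bins makes a bin of the first phase count as new when it is touched
      -- again. The start `L` lies above all earlier exponents.
      many h with play (map itm out) [] L cs₂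
      ... | out₂ , N₂ , O₂ , phase₂ =
        input , opt , many-bound {u} {length F} total cs≤ (length-N+O phase₂) (ceil (length O₂)) h cost≥
        where
        len₂ : length out₂ ≡ length cs₂
        len₂ = trans (sym (length-map col out₂)) (cong length (phase-colors phase₂))
        low₂ : All (λ p → expo p < L + L) (out ++ out₂)
        low₂ = All.++⁺ (All.map (λ h → ≤-trans h (m≤m+n L L)) low)
          (All.map (λ (_ , h) → <-≤-trans h (+-monoʳ-≤ L (^-monoʳ-≤ 2 (≤-trans cs₂≤M (≤-reflexive (sym (length-upTo M)))))))
            (phase-bounds phase₂))
        short₂ : length (out ++ out₂) ≤ B′
        short₂ = ≤-trans (≤-reflexive (length-++ out))
          (m≤n⇒m≤1+n (+-mono-≤ (≤-reflexive len-out) (≤-trans (≤-reflexive len₂) cs₂≤M)))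
        open Attack alg D B′ m L (L + L) out F os exec (All.map <⇒≤ low) (N⊆out phase ∘ F⊆N)
               (os⊆ ∘ F⊆N)
               (λ x∈ → ≤-antisym (os-length≤ (F⊆N x∈)) (proj₂ (∈-filter⁻ full? {xs = N} x∈)))
               (os-unique ∘ F⊆N) (AllPairs.filter⁺ full? (proj₁ (N-pairs phase))) owner
               (unique-map-filter outside? out-colors-unique) cs₂-free cover₂ out-colors
               (out-colors ∘ cs₂⊆)
               (λ c∈ → ∈-++⁺ˡ (subst (_ ∈_) (sym (phase-colors phase)) c∈)) phase₂ low₂ short₂ room
          using (input; opt; cost≥; cs≤; total)

      conclusion : Conclusion
      conclusion with ≤-total (length F + length F) m
      ... | inj₁ h = few h
      ... | inj₂ h = many h

  lower-bound : ∃[ I ] OptIs t I m × 4 * (t * m) ≤ 2 * (t * cost alg I) + 4 * t + m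
  lower-bound = let _ , _ , _ , phase = play [] [] 0 (upTo M) in Play.conclusion phase

-- From bounds for all large m to the competitive ratio

ratio : ∀ {t} (A : OnlineAlg t) p d .{{_ : NonZero d}} n → (∀ m → n ≤ m → ∃[ I ] OptIs t I m × p * m ≤ cost A I * d) →
        RatioAtLeast A (+ p / d)
ratio A p (suc d) n attack ε ε>0 Q₀ with attack (Q₀ + n) (m≤n+m n Q₀)
... | I , opt , bound = Q₀ + n , m≤m+n Q₀ n , I , opt , ℚ.≤-trans
      -- The attack achieves the ratio r itself, so ε enters only through r - ε ≤ r.
      (ℚ.*-monoʳ-≤-nonNeg (toℚ Q) {{ℚ.nonNegative (fr-nonNeg Q)}} r-ε≤r) (ℚ.toℚᵘ-cancel-≤ (begin
        ℚ.toℚᵘ (r ℚ.* toℚ Q)                          ≃⟨ ℚ.toℚᵘ-homo-* r (toℚ Q) ⟩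
        ℚ.toℚᵘ r ℚᵘ.* ℚ.toℚᵘ (toℚ Q)                  ≃⟨ ℚᵘ.*-cong (ℚ.toℚᵘ-fromℚᵘ (mkℚᵘ (+ p) d)) (ℚ.toℚᵘ-fromℚᵘ (mkℚᵘ (+ Q) 0)) ⟩
        mkℚᵘ (+ p) d ℚᵘ.* mkℚᵘ (+ Q) 0                ≤⟨ *≤* (subst₂ ℤ._≤_ lhs rhs (ℤ.+≤+ bound)) ⟩
        mkℚᵘ (+ cost A I) 0                           ≃⟨ ℚ.toℚᵘ-fromℚᵘ (mkℚᵘ (+ cost A I) 0) ⟨
        ℚ.toℚᵘ (toℚ (cost A I))                       ∎))
  where
  open ℚᵘ.≤-Reasoning
  Q = Q₀ + n
  r = + p / suc d
  fr-nonNeg : ∀ a → 0ℚ ℚ.≤ toℚ a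
  fr-nonNeg a = ℚ.nonNegative⁻¹ (toℚ a) {{ℚ.normalize-nonNeg a 1}}
  r-ε≤r : r ℚ.- ε ℚ.≤ r
  r-ε≤r = ℚ.≤-trans (ℚ.+-monoʳ-≤ r (ℚ.neg-antimono-≤ (ℚ.<⇒≤ ε>0))) (ℚ.≤-reflexive (ℚ.+-identityʳ r))
  lhs : + (p * Q) ≡ (+ p ℤ.* + Q) ℤ.* + 1
  lhs = trans (ℤ.pos-* p Q) (sym (ℤ.*-identityʳ _))
  rhs : + (cost A I * suc d) ≡ + cost A I ℤ.* (+ (suc d * 1))
  rhs = trans (ℤ.pos-* (cost A I) (suc d)) (cong (λ k → + cost A I ℤ.* + k) (sym (*-identityʳ (suc d))))

-- The hypotheses 2tp + k + d ≤ 4td ≤ 100k make p / d < 2 - 1 / 2t with room for the additive error.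
ratio-from-bound : ∀ v p d .{{_ : NonZero d}} k → 2 * (2 + v) * p + k + d ≤ d * (4 * (2 + v)) → d * (4 * (2 + v)) ≤ k * 100 →
                   (A : OnlineAlg (2 + v)) → RatioAtLeast A (+ p / d)
ratio-from-bound v p d k slack large A = ratio A p d 100 λ m 100≤m →
  let I , opt , h = lower-bound A m in I , opt , absorb m (cost A I) 100≤m h
  where
  open ≤-Reasoning
  t = 2 + v
  collect : ∀ t p k d m → 2 * t * (p * m) + (k * m + d * m) ≡ (2 * t * p + k + d) * m
  collect = solve-∀
  reorder : ∀ d t m → d * (4 * t) * m ≡ d * (4 * (t * m))
  reorder = solve-∀
  expand : ∀ d t C m → d * (2 * (t * C) + 4 * t + m) ≡ 2 * t * (C * d) + (d * (4 * t) + d * m)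
  expand = solve-∀
  absorb : ∀ m C → 100 ≤ m → 4 * (t * m) ≤ 2 * (t * C) + 4 * t + m → p * m ≤ C * d
  absorb m C 100≤m h = *-cancelˡ-≤ (2 * t) (+-cancelʳ-≤ (d * (4 * t) + d * m) _ _ (begin
    -- The margin `k * m` pays for the additive error, as m is at least 100.
    2 * t * (p * m) + (d * (4 * t) + d * m)   ≤⟨ +-monoʳ-≤ (2 * t * (p * m)) (+-monoˡ-≤ (d * m) (≤-trans large (*-monoʳ-≤ k 100≤m))) ⟩
    2 * t * (p * m) + (k * m + d * m)         ≡⟨ collect t p k d m ⟩
    (2 * t * p + k + d) * m                   ≤⟨ *-monoˡ-≤ m slack ⟩
    d * (4 * t) * m                           ≡⟨ reorder d t m ⟩
    d * (4 * (t * m))                         ≤⟨ *-monoʳ-≤ d h ⟩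
    d * (2 * (t * C) + 4 * t + m)             ≡⟨ expand d t C m ⟩
    2 * t * (C * d) + (d * (4 * t) + d * m)   ∎))

theorem4 : (∀ (A : OnlineAlg 2) → RatioAtLeast A (+ 1717668486 / 1000000000))
    × (∀ (A : OnlineAlg 3) → RatioAtLeast A (+ 180814287 / 100000000))
-- In both cases k is 4td / 100, the least value allowed by the second hypothesis; the gaps to 7/4
-- and 11/6 leave room for it in the first.
theorem4 = ratio-from-bound 0 1717668486 1000000000 80000000 (≤ᵇ⇒≤ _ _ _) (≤ᵇ⇒≤ _ _ _) ,
           ratio-from-bound 1 180814287 100000000 12000000 (≤ᵇ⇒≤ _ _ _) (≤ᵇ⇒≤ _ _ _)
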